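{- Let $p$ be an odd prime, $a\in\mathbb Z_p$ with $a\not\equiv-1\pmod p$, and $a'=(a-\langle a\rangle_p)/p$. Then $$\sum_{k=0}^{p-1}\binom ak\binom{ -1-a}k\binom{2k}k\frac k{4^k}\equiv a(a+1)S_p(a)-(a+1)^2S_p(a+1)+\frac{a'(a'+1)}{a+1}p^3\pmod{p^4}.$$ Moreover, if $a\not\equiv0\pmod p$, then $$\sum_{k=0}^{p-1}\binom ak\binom{ -1-a}k\binom{2k}k\frac k{4^k}\equiv a(a+1)\Big(2S_p(a)-\sum_{k=0}^{p-2}\binom ak\binom{ -1-a}k\binom{2k}k\frac1{4^k(k+1)}\Big)\pmod{p^3}.$$
   Context: For a prime $p$, $\mathbb Z_p$ denotes the set of rational numbers whose denominator is not divisible by $p$, and congruences modulo powers of $p$ are between elements of $\mathbb Z_p$ (the difference divided by that power of $p$ lies in $\mathbb Z_p$). For $a\in\mathbb Z_p$, $\langle a\rangle_p\in\{0,1,\ldots,p-1\}$ is determined by $a\equiv\langle a\rangle_p\pmod p$. For rational $a$ and integer $k\ge0$, $\binom ak=a(a-1)\cdots(a-k+1)/k!$. Define $S_n(a)=\sum_{k=0}^{n-1}\binom ak\binom{ -1-a}k\binom{2k}k\frac1{4^k}$ for $n\ge1$. -}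

module Defs where

open import Data.Empty using (⊥-elim)
open import Data.Fin.Base using (Fin; toℕ; fromℕ<)
open import Data.Fin.Properties using (toℕ-fromℕ<; toℕ-injective; toℕ<n)
import Data.Integer.Base as ℤ
import Data.Integer.Properties as ℤ
import Data.Integer.DivMod as ℤ
import Data.Integer.GCD as ℤ
import Data.Integer.Solver as ℤ
open import Data.Nat.Base as ℕ using (ℕ; zero; suc; NonZero; _^_; _!)
open import Data.Nat.Combinatorics using (_C_)
open import Data.Nat.Coprimality using (Coprime; coprime-Bézout)
open import Data.Nat.Divisibility
  using (_∣_; _∤_; ∣-trans; m∣m*n; n∣m*n; ∣1⇒≡1; >⇒∤)
open import Data.Nat.GCD using (module Bézout)
open import Data.Nat.Primality
  using (Prime; prime⇒nonZero; prime⇒irreducible; ¬prime[1]; euclidsLemma)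
import Data.Nat.Properties as ℕ
open import Data.Product using (∃₂; ∃!; _,_; proj₁; proj₂)
open import Data.Rational.Base hiding (NonZero)
import Data.Rational.Base as ℚ
open import Data.Rational.Properties
open import Data.Rational.Solver using (module +-*-Solver)
open import Data.Rational.Unnormalised.Base as ℚᵘ using (mkℚᵘ)
import Data.Rational.Unnormalised.Properties as ℚᵘ
open import Data.Sum.Base using (inj₁; inj₂)
open import Relation.Binary.PropositionalEquality
open import Relation.Nullary.Negation using (¬_)

open import Algebra.Properties.CommutativeMonoid.Sum +-0-commutativeMonoid public
  using (sum; sum-syntax)

fromℕ : ℕ → ℚ
fromℕ n = ℤ.+ n / 1

1/4^_ : ℕ → ℚ
1/4^ k = (ℤ.+ 1 / (4 ^ k)) {{ℕ.m^n≢0 4 k}}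

fallingFactorial : ℚ → ℕ → ℚ
fallingFactorial a zero    = 1ℚ
fallingFactorial a (suc k) = fallingFactorial a k * (a - fromℕ k)

binom : ℚ → ℕ → ℚ
binom a k = fallingFactorial a k * (ℤ.+ 1 / (k !)) {{k ℕ.!≢0}}

-- The factor C(a,k) C(-1-a,k) C(2k,k) shared by all the sums.
B : ℚ → ℕ → ℚ
B a k = binom a k * binom (- 1ℚ - a) k * fromℕ ((2 ℕ.* k) C k)

S : ℕ → ℚ → ℚ
S n a = ∑[ k < n ] (B a (toℕ k) * 1/4^ (toℕ k))

-- Everything relative to a prime p; ℤₚ is the localisation of ℤ at p inside ℚ.
module AtPrime {p : ℕ} (p-prime : Prime p) where

  private instance
    p≢0 : NonZero p
    p≢0 = prime⇒nonZero p-prime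

  infix 4 _∈ℤₚ _≡_[modp^_]

  -- A value of type ℚ is in lowest terms, so ↧ₙ is the reduced denominator.
  _∈ℤₚ : ℚ → Set
  x ∈ℤₚ = p ∤ ↧ₙ x

  1/p^_ : ℕ → ℚ
  1/p^ n = (ℤ.+ 1 / (p ^ n)) {{ℕ.m^n≢0 p n}}

  -- Congruences are between elements of ℤₚ, so membership of both sides is part
  -- of the relation.
  record _≡_[modp^_] (x y : ℚ) (n : ℕ) : Set where
    constructor congruent
    field
      left∈ℤₚ     : x ∈ℤₚ
      right∈ℤₚ    : y ∈ℤₚ
      quotient∈ℤₚ : (x - y) * 1/p^ n ∈ℤₚ

  private
    p∤1 : p ∤ 1
    p∤1 p∣1 = ¬prime[1] (subst Prime (∣1⇒≡1 p∣1) p-prime)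

    p∤* : ∀ {m n} → p ∤ m → p ∤ n → p ∤ m ℕ.* n
    p∤* p∤m p∤n p∣mn with euclidsLemma _ _ p-prime p∣mn
    ... | inj₁ p∣m = p∤m p∣m
    ... | inj₂ p∣n = p∤n p∣n

    /∈ℤₚ : ∀ i d .{{_ : NonZero d}} → p ∤ d → i / d ∈ℤₚ
    /∈ℤₚ i d p∤d p∣ = p∤d (∣-trans p∣ (subst (↧ₙ (i / d) ∣_) eq (m∣m*n ℤ.∣ g ∣)))
      where
      g  = ℤ.gcd i (ℤ.+ d)
      eq : ↧ₙ (i / d) ℕ.* ℤ.∣ g ∣ ≡ d
      eq = trans (sym (ℤ.abs-* (↧ (i / d)) g)) (cong ℤ.∣_∣ (↧-/ i d))

    +∈ℤₚ : ∀ x y → x ∈ℤₚ → y ∈ℤₚ → x + y ∈ℤₚ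
    +∈ℤₚ x@record{} y@record{} hx hy =
      /∈ℤₚ (↥ x ℤ.* ↧ y ℤ.+ ↥ y ℤ.* ↧ x) (↧ₙ x ℕ.* ↧ₙ y) (p∤* {↧ₙ x} {↧ₙ y} hx hy)

    neg∈ℤₚ : ∀ y → y ∈ℤₚ → - y ∈ℤₚ
    neg∈ℤₚ (mkℚ (ℤ.+ 0)    _ _) hy = hy
    neg∈ℤₚ (mkℚ ℤ.+[1+ _ ] _ _) hy = hy
    neg∈ℤₚ (mkℚ ℤ.-[1+ _ ] _ _) hy = hy

    inverse : ∀ d → p ∤ d → ∃₂ λ e t → e ℤ.* ℤ.+ d ≡ ℤ.+ 1 ℤ.+ t ℤ.* ℤ.+ p
    inverse d p∤d with coprime-Bézout coprime
      where
      coprime : Coprime p d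
      coprime (i∣p , i∣d) with prime⇒irreducible p-prime i∣p
      ... | inj₁ i≡1 = i≡1
      ... | inj₂ i≡p = ⊥-elim (p∤d (subst (_∣ d) i≡p i∣d))
    ... | Bézout.-+ x y eq = ℤ.+ y , ℤ.+ x , (begin
      ℤ.+ y ℤ.* ℤ.+ d             ≡⟨ ℤ.pos-* y d ⟨
      ℤ.+ (y ℕ.* d)               ≡⟨ cong ℤ.+_ eq ⟨
      ℤ.+ (1 ℕ.+ x ℕ.* p)         ≡⟨ cong (λ u → ℤ.+ 1 ℤ.+ u) (ℤ.pos-* x p) ⟩
      ℤ.+ 1 ℤ.+ ℤ.+ x ℤ.* ℤ.+ p   ∎)
      where open ≡-Reasoning
    ... | Bézout.+- x y eq = ℤ.- ℤ.+ y , ℤ.- ℤ.+ x , (begin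
      ℤ.- ℤ.+ y ℤ.* ℤ.+ d
        ≡⟨ solve 2 (λ y d → :- y :* d := con (ℤ.+ 1) :- (con (ℤ.+ 1) :+ y :* d)) refl (ℤ.+ y) (ℤ.+ d) ⟩
      ℤ.+ 1 ℤ.- (ℤ.+ 1 ℤ.+ ℤ.+ y ℤ.* ℤ.+ d)
        ≡⟨ cong (λ u → ℤ.+ 1 ℤ.- (ℤ.+ 1 ℤ.+ u)) (ℤ.pos-* y d) ⟨
      ℤ.+ 1 ℤ.- ℤ.+ (1 ℕ.+ y ℕ.* d)
        ≡⟨ cong (λ u → ℤ.+ 1 ℤ.- ℤ.+ u) eq ⟩
      ℤ.+ 1 ℤ.- ℤ.+ (x ℕ.* p)
        ≡⟨ cong (λ u → ℤ.+ 1 ℤ.- u) (ℤ.pos-* x p) ⟩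
      ℤ.+ 1 ℤ.- ℤ.+ x ℤ.* ℤ.+ p
        ≡⟨ solve 2 (λ x p → con (ℤ.+ 1) :- x :* p := con (ℤ.+ 1) :+ :- x :* p) refl (ℤ.+ x) (ℤ.+ p) ⟩
      ℤ.+ 1 ℤ.+ ℤ.- ℤ.+ x ℤ.* ℤ.+ p ∎)
      where
      open ≡-Reasoning
      open ℤ.+-*-Solver

    residueℤ : ∀ n d → p ∤ d →
               ∃₂ λ (r : Fin p) q → n ≡ ℤ.+ toℕ r ℤ.* ℤ.+ d ℤ.+ q ℤ.* ℤ.+ p
    residueℤ n d p∤d with inverse d p∤d
    ... | e , t , ed≡1+tp =
      fromℕ< r<p , k ℤ.* ℤ.+ d ℤ.- n ℤ.* t , (begin
      n
        ≡⟨ solve 3 (λ n t p → n := n :* (con (ℤ.+ 1) :+ t :* p) :- n :* t :* p) refl n t (ℤ.+ p) ⟩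
      n ℤ.* (ℤ.+ 1 ℤ.+ t ℤ.* ℤ.+ p) ℤ.- n ℤ.* t ℤ.* ℤ.+ p
        ≡⟨ cong (λ u → n ℤ.* u ℤ.- n ℤ.* t ℤ.* ℤ.+ p) ed≡1+tp ⟨
      n ℤ.* (e ℤ.* ℤ.+ d) ℤ.- n ℤ.* t ℤ.* ℤ.+ p
        ≡⟨ cong (λ u → u ℤ.- n ℤ.* t ℤ.* ℤ.+ p) (ℤ.*-assoc n e (ℤ.+ d)) ⟨
      n ℤ.* e ℤ.* ℤ.+ d ℤ.- n ℤ.* t ℤ.* ℤ.+ p
        ≡⟨ cong (λ u → u ℤ.* ℤ.+ d ℤ.- n ℤ.* t ℤ.* ℤ.+ p) (ℤ.a≡a%ℕn+[a/ℕn]*n (n ℤ.* e) p) ⟩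
      (ℤ.+ r ℤ.+ k ℤ.* ℤ.+ p) ℤ.* ℤ.+ d ℤ.- n ℤ.* t ℤ.* ℤ.+ p
        ≡⟨ solve 6 (λ r k p d n t →
             (r :+ k :* p) :* d :- n :* t :* p := r :* d :+ (k :* d :- n :* t) :* p)
             refl (ℤ.+ r) k (ℤ.+ p) (ℤ.+ d) n t ⟩
      ℤ.+ r ℤ.* ℤ.+ d ℤ.+ (k ℤ.* ℤ.+ d ℤ.- n ℤ.* t) ℤ.* ℤ.+ p
        ≡⟨ cong (λ u → ℤ.+ u ℤ.* ℤ.+ d ℤ.+ (k ℤ.* ℤ.+ d ℤ.- n ℤ.* t) ℤ.* ℤ.+ p) (toℕ-fromℕ< r<p) ⟨
      ℤ.+ toℕ (fromℕ< r<p) ℤ.* ℤ.+ d ℤ.+ (k ℤ.* ℤ.+ d ℤ.- n ℤ.* t) ℤ.* ℤ.+ p ∎)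
      where
      open ≡-Reasoning
      open ℤ.+-*-Solver
      r   = (n ℤ.* e) ℤ.%ℕ p
      k   = (n ℤ.* e) ℤ./ℕ p
      r<p = ℤ.n%ℕd<d (n ℤ.* e) p

    fromℕ∈ℤₚ : ∀ n → fromℕ n ∈ℤₚ
    fromℕ∈ℤₚ n = /∈ℤₚ (ℤ.+ n) 1 p∤1

    1/p : ℚ
    1/p = ℤ.+ 1 / p

    1/p^1≡1/p : 1/p^ 1 ≡ 1/p
    1/p^1≡1/p = /-cong {p₁ = ℤ.+ 1} {{ℕ.m^n≢0 p 1}} refl (ℕ.*-identityʳ p)

    toℚᵘ-/ : ∀ i d .{{_ : NonZero d}} → toℚᵘ (i / d) ℚᵘ.≃ i ℚᵘ./ d
    toℚᵘ-/ i (suc d) = toℚᵘ-fromℚᵘ (mkℚᵘ i d)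

    toℚᵘ-neg : ∀ x → toℚᵘ (- x) ≡ ℚᵘ.- toℚᵘ x
    toℚᵘ-neg (mkℚ (ℤ.+ 0)     _ _) = refl
    toℚᵘ-neg (mkℚ ℤ.+[1+ _ ]  _ _) = refl
    toℚᵘ-neg (mkℚ ℤ.-[1+ _ ]  _ _) = refl

    toℚᵘ-[-r]/p : ∀ x r → toℚᵘ ((x - fromℕ r) * 1/p^ 1) ℚᵘ.≃
                  (toℚᵘ x ℚᵘ.- (ℤ.+ r ℚᵘ./ 1)) ℚᵘ.* (ℤ.+ 1 ℚᵘ./ p)
    toℚᵘ-[-r]/p x r = begin
      toℚᵘ ((x - fromℕ r) * 1/p^ 1)
        ≡⟨ cong (λ u → toℚᵘ ((x - fromℕ r) * u)) 1/p^1≡1/p ⟩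
      toℚᵘ ((x - fromℕ r) * 1/p)
        ≈⟨ toℚᵘ-homo-* (x - fromℕ r) 1/p ⟩
      toℚᵘ (x - fromℕ r) ℚᵘ.* toℚᵘ 1/p
        ≈⟨ ℚᵘ.*-cong (toℚᵘ-homo-+ x (- fromℕ r)) (toℚᵘ-/ (ℤ.+ 1) p) ⟩
      (toℚᵘ x ℚᵘ.+ toℚᵘ (- fromℕ r)) ℚᵘ.* (ℤ.+ 1 ℚᵘ./ p)
        ≡⟨ cong (λ u → (toℚᵘ x ℚᵘ.+ u) ℚᵘ.* (ℤ.+ 1 ℚᵘ./ p)) (toℚᵘ-neg (fromℕ r)) ⟩
      (toℚᵘ x ℚᵘ.- toℚᵘ (fromℕ r)) ℚᵘ.* (ℤ.+ 1 ℚᵘ./ p)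
        ≈⟨ ℚᵘ.*-congʳ {ℤ.+ 1 ℚᵘ./ p} (ℚᵘ.+-congʳ (toℚᵘ x) (ℚᵘ.-‿cong (toℚᵘ-/ (ℤ.+ r) 1))) ⟩
      (toℚᵘ x ℚᵘ.- (ℤ.+ r ℚᵘ./ 1)) ℚᵘ.* (ℤ.+ 1 ℚᵘ./ p) ∎
      where open ℚᵘ.≃-Reasoning

    crossℤ : ∀ n d r q m .{{_ : NonZero m}} →
             n ≡ ℤ.+ r ℤ.* ℤ.+ suc d ℤ.+ q ℤ.* ℤ.+ m →
             (mkℚᵘ n d ℚᵘ.- (ℤ.+ r ℚᵘ./ 1)) ℚᵘ.* (ℤ.+ 1 ℚᵘ./ m) ℚᵘ.≃ mkℚᵘ q d
    crossℤ n d r q (suc m) refl = ℚᵘ.*≡* (begin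
      ((n ℤ.* ℤ.+ 1 ℤ.+ ℤ.- ℤ.+ r ℤ.* D) ℤ.* ℤ.+ 1) ℤ.* D
        ≡⟨ solve 4 (λ r d q m →
             ((r :* d :+ q :* m) :* con (ℤ.+ 1) :+ :- r :* d) :* con (ℤ.+ 1) :* d
               := q :* (d :* con (ℤ.+ 1) :* m)) refl (ℤ.+ r) D q M ⟩
      q ℤ.* (D ℤ.* ℤ.+ 1 ℤ.* M)
        ≡⟨⟩
      q ℤ.* ℤ.+ (suc d ℕ.* 1 ℕ.* suc m) ∎)
      where
      open ≡-Reasoning
      open ℤ.+-*-Solver
      D = ℤ.+ suc d
      M = ℤ.+ suc m

    toℚᵘ≃⇒≡/ : ∀ z q d → toℚᵘ z ℚᵘ.≃ mkℚᵘ q d → z ≡ q / suc d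
    toℚᵘ≃⇒≡/ z q d z≃ = trans (sym (fromℚᵘ-toℚᵘ z)) (fromℚᵘ-cong {toℚᵘ z} {mkℚᵘ q d} z≃)

    toℚᵘ-η : ∀ a → toℚᵘ a ≡ mkℚᵘ (↥ a) (ℚ.denominator-1 a)
    toℚᵘ-η (mkℚ _ _ _) = refl

    -- Stated for an abstract a: matching on it would unfold the arithmetic of ℚ.
    residue-quotient : ∀ a r q →
      ↥ a ≡ ℤ.+ r ℤ.* ↧ a ℤ.+ q ℤ.* ℤ.+ p → (a - fromℕ r) * 1/p^ 1 ≡ q / ↧ₙ a
    residue-quotient a r q eq = toℚᵘ≃⇒≡/ ((a - fromℕ r) * 1/p^ 1) q (ℚ.denominator-1 a)
      (ℚᵘ.≃-trans (toℚᵘ-[-r]/p a r)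
        (subst (λ u → (u ℚᵘ.- (ℤ.+ r ℚᵘ./ 1)) ℚᵘ.* (ℤ.+ 1 ℚᵘ./ p) ℚᵘ.≃ mkℚᵘ q (ℚ.denominator-1 a))
          (sym (toℚᵘ-η a))
          (crossℤ (↥ a) (ℚ.denominator-1 a) r q p eq)))

    exists : ∀ a → a ∈ℤₚ → ∃₂ λ (r : Fin p) q → (a - fromℕ (toℕ r)) * 1/p^ 1 ≡ q / ↧ₙ a
    exists a a∈ℤₚ =
      let r , q , eq = residueℤ (↥ a) (↧ₙ a) a∈ℤₚ
      in  r , q , residue-quotient a (toℕ r) q eq

    p∣-if : ∀ r s m .{{_ : NonZero m}} x → p ∤ ↧ₙ x →
            toℚᵘ x ℚᵘ.≃ ((ℤ.+ s ℚᵘ./ 1) ℚᵘ.- (ℤ.+ r ℚᵘ./ 1)) ℚᵘ.* (ℤ.+ 1 ℚᵘ./ m) →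
            m ≡ p → p ∣ ℤ.∣ s ℤ.⊖ r ∣
    p∣-if r s (suc m) x@record{} p∤x (ℚᵘ.*≡* eq) refl with euclidsLemma _ _ p-prime
      (subst (p ∣_) (trans (sym (ℤ.abs-* (↥ x) (ℤ.+ p))) (trans (cong ℤ.∣_∣ eq′) (ℤ.abs-* (s ℤ.⊖ r) (↧ x))))
        (n∣m*n ℤ.∣ ↥ x ∣))
      where
      open ≡-Reasoning
      open ℤ.+-*-Solver
      eq′ : ↥ x ℤ.* ℤ.+ p ≡ (s ℤ.⊖ r) ℤ.* ↧ x
      eq′ = begin
        ↥ x ℤ.* ℤ.+ p
          ≡⟨ cong (λ u → ↥ x ℤ.* ℤ.+ u) (ℕ.*-identityˡ p) ⟨
        ↥ x ℤ.* ℤ.+ (1 ℕ.* 1 ℕ.* p)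
          ≡⟨ eq ⟩
        ((ℤ.+ s ℤ.* ℤ.+ 1 ℤ.+ ℤ.- ℤ.+ r ℤ.* ℤ.+ 1) ℤ.* ℤ.+ 1) ℤ.* ↧ x
          ≡⟨ solve 3 (λ s r y → ((s :* con (ℤ.+ 1) :+ :- r :* con (ℤ.+ 1)) :* con (ℤ.+ 1)) :* y
               := (s :- r) :* y) refl (ℤ.+ s) (ℤ.+ r) (↧ x) ⟩
        (ℤ.+ s ℤ.- ℤ.+ r) ℤ.* ↧ x
          ≡⟨ cong (ℤ._* ↧ x) (ℤ.m-n≡m⊖n s r) ⟩
        (s ℤ.⊖ r) ℤ.* ↧ x ∎
    ... | inj₁ p∣ = p∣
    ... | inj₂ p∣ = ⊥-elim (p∤x p∣)

    unique : ∀ {a} {r s : Fin p} → a ≡ fromℕ (toℕ r) [modp^ 1 ] →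
             a ≡ fromℕ (toℕ s) [modp^ 1 ] → r ≡ s
    unique {a} {r} {s} (congruent _ _ hr) (congruent _ _ hs) =
      toℕ-injective (sym (close (toℕ s) (toℕ r) (toℕ<n s) (toℕ<n r) p∣))
      where
      open +-*-Solver
      dr = (a - fromℕ (toℕ r)) * 1/p^ 1
      ds = (a - fromℕ (toℕ s)) * 1/p^ 1
      w = (fromℕ (toℕ s) - fromℕ (toℕ r)) * 1/p^ 1
      w∈ℤₚ : w ∈ℤₚ
      w∈ℤₚ = subst _∈ℤₚ
        (solve 4 (λ a r s c → (a :- r) :* c :- (a :- s) :* c := (s :- r) :* c) refl
          a (fromℕ (toℕ r)) (fromℕ (toℕ s)) (1/p^ 1))
        (+∈ℤₚ dr (- ds) hr (neg∈ℤₚ ds hs))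
      s≃ : ℚᵘ._≃_ (toℚᵘ (fromℕ (toℕ s))) (ℤ.+ toℕ s ℚᵘ./ 1)
      s≃ = toℚᵘ-/ (ℤ.+ toℕ s) 1
      p∣ : p ∣ ℤ.∣ toℕ s ℤ.⊖ toℕ r ∣
      p∣ = p∣-if (toℕ r) (toℕ s) p w w∈ℤₚ
        (ℚᵘ.≃-trans (toℚᵘ-[-r]/p (fromℕ (toℕ s)) (toℕ r))
          (ℚᵘ.*-congʳ {ℤ.+ 1 ℚᵘ./ p} (ℚᵘ.+-congˡ (ℚᵘ.- (ℤ.+ toℕ r ℚᵘ./ 1)) s≃)))
        refl
      close : ∀ s r → s ℕ.< p → r ℕ.< p → p ∣ ℤ.∣ s ℤ.⊖ r ∣ → s ≡ r
      close s r s<p r<p p∣s-r with ℤ.∣ s ℤ.⊖ r ∣ in eq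
      ... | zero  = ℤ.+-injective (ℤ.i-j≡0⇒i≡j (ℤ.+ s) (ℤ.+ r)
                      (trans (ℤ.m-n≡m⊖n s r) (ℤ.∣i∣≡0⇒i≡0 eq)))
      ... | suc k = ⊥-elim (>⇒∤ (ℕ.≤-<-trans
                      (subst (ℕ._≤ s ℕ.⊔ r) eq (ℤ.∣m⊝n∣≤m⊔n s r))
                      (ℕ.⊔-lub s<p r<p)) p∣s-r)

  -- Abstract, so that only the characterisation in the type is visible.
  abstract
    residue : ∀ a → a ∈ℤₚ → ∃! _≡_ λ (r : Fin p) → a ≡ fromℕ (toℕ r) [modp^ 1 ]
    residue a a∈ℤₚ = r , r-ok , unique r-ok
      where
      ex : ∃₂ λ (r : Fin p) q → (a - fromℕ (toℕ r)) * 1/p^ 1 ≡ q / ↧ₙ a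
      ex = exists a a∈ℤₚ
      r : Fin p
      r = proj₁ ex
      r-ok : a ≡ fromℕ (toℕ r) [modp^ 1 ]
      r-ok = congruent a∈ℤₚ (fromℕ∈ℤₚ (toℕ r))
        (subst _∈ℤₚ (sym (proj₂ (proj₂ ex))) (/∈ℤₚ (proj₁ (proj₂ ex)) (↧ₙ a) a∈ℤₚ))

  ⟨_,_⟩ₚ : ∀ a → a ∈ℤₚ → ℕ
  ⟨ a , a∈ℤₚ ⟩ₚ = toℕ (proj₁ (residue a a∈ℤₚ))

  a≢-1⇒a+1≢0 : ∀ {a} → a ∈ℤₚ → ¬ (a ≡ - 1ℚ [modp^ 1 ]) → ℚ.NonZero (a + 1ℚ)
  a≢-1⇒a+1≢0 {a} a∈ℤₚ a≢-1 = ℚ.≢-nonZero {a + 1ℚ} λ a+1≡0 →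
    a≢-1 (congruent a∈ℤₚ p∤1 (subst _∈ℤₚ (sym (quotient≡0 a+1≡0)) p∤1))
    where
    quotient≡0 : a + 1ℚ ≡ 0ℚ → (a - - 1ℚ) * 1/p^ 1 ≡ 0ℚ
    quotient≡0 a+1≡0 = trans (cong (_* 1/p^ 1) a+1≡0) (*-zeroˡ (1/p^ 1))

{-# OPTIONS --safe #-}

-- Write T a k for the k-th summand of S. Both k T a k − a(a+1) T a k + (a+1)² T (a+1) k and
-- k T a k − 2a(a+1) T a k + a(a+1) T a k / (k+1) telescope, so with m = p − 1 the two congruences
-- become statements about the boundary terms (2m+1)(a+1+m) T a m and
-- (m(2m+1) − 2a(a+1)) T a m. Up to the unit a+1 and powers of m!, the first one is minus the
-- product of the falling factorials of length p of a+1, −1−a and m+½ (the last one doubled).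
-- Each runs over a complete residue system, and x(x−1)⋯(x−p+1) ≡ p y m! (mod p²) when
-- x = s + p y with 0 ≤ s < p; here y is a′, −(a′+1) and ½ respectively. Hence the first boundary
-- term is a′(a′+1)p³/(a+1) modulo p⁴, and if p ∤ a then 2m+1 and a+1+m are units, so p³ divides T a m.
module Submission where

open import Defs
open import Data.Empty using (⊥-elim)
open import Data.Fin.Base using (Fin; toℕ)
open import Data.Fin.Properties using (toℕ-inject₁; toℕ-fromℕ; toℕ<n)
open import Data.Integer.Base as ℤ using (+_)
import Data.Integer.Divisibility.Signed as ℤ
open import Data.Integer.GCD using (gcd)
import Data.Integer.Properties as ℤ
open import Data.Nat.Base as ℕ using (ℕ; zero; suc; NonZero; _∸_; _^_; _!)
open import Data.Nat.Combinatorics using (_C_; nCk≡n!/k![n-k]!; k![n∸k]!∣n!)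
open import Data.Nat.Coprimality as Coprimality using (1-coprimeTo)
open import Data.Nat.Divisibility
  using (_∣_; _∤_; _∣0; ∣-refl; ∣-trans; m∣m*n; n∣m*n; ∣1⇒≡1; >⇒∤; ∣m∣n⇒∣m+n; ∣m+n∣m⇒∣n)
open import Data.Nat.DivMod using (m/n*n≡m)
open import Data.Nat.Primality
  using (Prime; prime[2]; ¬prime[0]; ¬prime[1]; prime⇒nonZero; prime⇒irreducible; euclidsLemma)
import Data.Nat.Properties as ℕ
import Data.Nat.Solver as ℕ
open import Data.Product.Base using (_×_; _,_; ∃; proj₁; proj₂)
import Data.Rational.Base as ℚ
open import Data.Rational.Base
  using (ℚ; mkℚ; 0ℚ; 1ℚ; ½; _+_; _-_; -_; _*_; _/_; _÷_; 1/_; ↥_; ↧_; ↧ₙ_; toℚᵘ)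
open import Data.Rational.Properties
open import Algebra.Properties.CommutativeMonoid.Sum +-0-commutativeMonoid
  using (sum-init-last; sum-cong-≗)
open import Data.Rational.Solver using (module +-*-Solver)
open import Data.Rational.Unnormalised.Base as ℚᵘ using (mkℚᵘ)
import Data.Rational.Unnormalised.Properties as ℚᵘ
open import Data.Sum.Base using (inj₁; inj₂)
open import Relation.Binary.PropositionalEquality
open import Relation.Nullary.Negation using (¬_)

open +-*-Solver

-- Natural numbers and their reciprocals inside ℚ.

ff : ℚ → ℕ → ℚ
ff = fallingFactorial

1/ℕ : ∀ n .{{_ : NonZero n}} → ℚ
1/ℕ n = + 1 / n

1/fact : ℕ → ℚ
1/fact k = 1/ℕ (k ℕ.!) {{k ℕ.!≢0}}

-- `_/_` reduces by a gcd that is stuck on a variable; with an explicit `mkℚ` the operations `_+_`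
-- and `_*_` can unfold.
fromℕ-mkℚ : ∀ n → fromℕ n ≡ mkℚ (+ n) 0 (Coprimality.sym (1-coprimeTo n))
fromℕ-mkℚ n = normalize-coprime (Coprimality.sym (1-coprimeTo n))

fromℕ-+ : ∀ m n → fromℕ (m ℕ.+ n) ≡ fromℕ m + fromℕ n
fromℕ-+ m n = trans
  (cong (_/ 1) (sym (cong₂ ℤ._+_ (ℤ.*-identityʳ (+ m)) (ℤ.*-identityʳ (+ n)))))
  (sym (cong₂ _+_ (fromℕ-mkℚ m) (fromℕ-mkℚ n)))

fromℕ-* : ∀ m n → fromℕ (m ℕ.* n) ≡ fromℕ m * fromℕ n
fromℕ-* m n = trans
  (cong (_/ 1) (ℤ.pos-* m n))
  (sym (cong₂ _*_ (fromℕ-mkℚ m) (fromℕ-mkℚ n)))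

fromℕ-suc : ∀ n → fromℕ (suc n) ≡ 1ℚ + fromℕ n
fromℕ-suc = fromℕ-+ 1

fromℕ-1/ℕ : ∀ n .{{_ : NonZero n}} → fromℕ n * 1/ℕ n ≡ 1ℚ
fromℕ-1/ℕ (suc n) = trans
  (cong₂ _*_ (fromℕ-mkℚ (suc n)) (normalize-coprime (1-coprimeTo (suc n))))
  (*-inverseʳ (mkℚ (+ suc n) 0 (Coprimality.sym (1-coprimeTo (suc n)))))

inverse-unique : ∀ {x y z} → x * y ≡ 1ℚ → x * z ≡ 1ℚ → y ≡ z
inverse-unique {x} {y} {z} xy≡1 xz≡1 = begin
  y            ≡⟨ *-identityʳ y ⟨
  y * 1ℚ       ≡⟨ cong (y *_) xz≡1 ⟨
  y * (x * z)  ≡⟨ solve 3 (λ x y z → y :* (x :* z) := x :* y :* z) refl x y z ⟩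
  x * y * z    ≡⟨ cong (_* z) xy≡1 ⟩
  1ℚ * z       ≡⟨ *-identityˡ z ⟩
  z            ∎
  where open ≡-Reasoning

-- Both sides invert `n`. Applied to `k !` and `4 ^ k`, this writes the reciprocal at `k` as an
-- integer multiple of the one at `k + 1`, which keeps the recurrences free of division.
1/ℕ-* : ∀ m n .{{_ : NonZero n}} .{{_ : NonZero (m ℕ.* n)}} →
        1/ℕ n ≡ fromℕ m * 1/ℕ (m ℕ.* n)
1/ℕ-* m n = inverse-unique {fromℕ n} (fromℕ-1/ℕ n) (begin
  fromℕ n * (fromℕ m * 1/ℕ (m ℕ.* n))
    ≡⟨ solve 3 (λ n m i → n :* (m :* i) := m :* n :* i) refl (fromℕ n) (fromℕ m) (1/ℕ (m ℕ.* n)) ⟩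
  fromℕ m * fromℕ n * 1/ℕ (m ℕ.* n)
    ≡⟨ cong (_* 1/ℕ (m ℕ.* n)) (fromℕ-* m n) ⟨
  fromℕ (m ℕ.* n) * 1/ℕ (m ℕ.* n)
    ≡⟨ fromℕ-1/ℕ (m ℕ.* n) ⟩
  1ℚ ∎)
  where open ≡-Reasoning

1/!-suc : ∀ k → 1/fact k ≡ fromℕ (suc k) * 1/fact (suc k)
1/!-suc k = 1/ℕ-* (suc k) (k ℕ.!) {{k ℕ.!≢0}} {{suc k ℕ.!≢0}}

1/4^-suc : ∀ k → 1/4^ k ≡ fromℕ 4 * 1/4^ (suc k)
1/4^-suc k = 1/ℕ-* 4 (4 ^ k) {{ℕ.m^n≢0 4 k}} {{ℕ.m^n≢0 4 (suc k)}}

-- Before reduction both sides are the same fraction, so the comparison takes place among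
-- unnormalised rationals. It serves to pull a factor p out of a numerator.
/-*-/ : ∀ i d j e .{{_ : NonZero d}} .{{_ : NonZero e}} .{{_ : NonZero (d ℕ.* e)}} →
        (i / d) * (j / e) ≡ (i ℤ.* j) / (d ℕ.* e)
/-*-/ i (suc d) j (suc e) = toℚᵘ-injective (begin
  toℚᵘ ((i / suc d) * (j / suc e))          ≈⟨ toℚᵘ-homo-* (i / suc d) (j / suc e) ⟩
  toℚᵘ (i / suc d) ℚᵘ.* toℚᵘ (j / suc e)    ≈⟨ ℚᵘ.*-cong (toℚᵘ-fromℚᵘ (mkℚᵘ i d)) (toℚᵘ-fromℚᵘ (mkℚᵘ j e)) ⟩
  mkℚᵘ i d ℚᵘ.* mkℚᵘ j e                    ≈⟨ toℚᵘ-fromℚᵘ (mkℚᵘ i d ℚᵘ.* mkℚᵘ j e) ⟨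
  toℚᵘ ((i ℤ.* j) / (suc d ℕ.* suc e))      ∎)
  where open ℚᵘ.≃-Reasoning

-- Finite sums and falling factorials.

sum-last : ∀ (f : ℕ → ℚ) n → ∑[ k < suc n ] f (toℕ k) ≡ ∑[ k < n ] f (toℕ k) + f n
-- `sum` peels off the first term by definition, whereas the telescoping inductions add a last one.
sum-last f n = trans (sum-init-last (λ (k : Fin (suc n)) → f (toℕ k)))
  (cong₂ _+_ (sum-cong-≗ (λ (k : Fin n) → cong f (toℕ-inject₁ k))) (cong f (toℕ-fromℕ n)))

-- The definition recurses on the last factor; isolating the first one makes arguments that differ
-- by 1 comparable.
ff-shift : ∀ x k → ff x (suc k) ≡ x * ff (x - 1ℚ) k
ff-shift x zero    = solve 1 (λ x → con 1ℚ :* (x :- con 0ℚ) := x :* con 1ℚ) refl x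
ff-shift x (suc k) = begin
  ff x (suc k) * (x - fromℕ (suc k))
    ≡⟨ cong₂ (λ f n → f * (x - n)) (ff-shift x k) (fromℕ-suc k) ⟩
  x * ff (x - 1ℚ) k * (x - (1ℚ + fromℕ k))
    ≡⟨ solve 3 (λ x f k → x :* f :* (x :- (con 1ℚ :+ k)) := x :* (f :* (x :- con 1ℚ :- k)))
         refl x (ff (x - 1ℚ) k) (fromℕ k) ⟩
  x * (ff (x - 1ℚ) k * (x - 1ℚ - fromℕ k)) ∎
  where open ≡-Reasoning

ff-shift⁺ : ∀ x k → ff (x + 1ℚ) (suc k) ≡ (x + 1ℚ) * ff x k
ff-shift⁺ x k = trans (ff-shift (x + 1ℚ) k)
  (cong (λ y → (x + 1ℚ) * ff y k) (solve 1 (λ x → x :+ con 1ℚ :- con 1ℚ := x) refl x))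

ff-fromℕ-suc : ∀ n k → ff (fromℕ (suc n)) (suc k) ≡ fromℕ (suc n) * ff (fromℕ n) k
ff-fromℕ-suc n k = subst (λ y → ff y (suc k) ≡ y * ff (fromℕ n) k)
  (trans (+-comm (fromℕ n) 1ℚ) (sym (fromℕ-suc n))) (ff-shift⁺ (fromℕ n) k)

ff-! : ∀ n → ff (fromℕ n) n ≡ fromℕ (n !)
ff-! zero    = refl
ff-! (suc n) = trans (ff-fromℕ-suc n n)
  (trans (cong (fromℕ (suc n) *_) (ff-! n)) (sym (fromℕ-* (suc n) (n !))))

-- One of the factors `n - 0`, ..., `n - (k - 1)` is zero; peeling off first factors lowers `n` and
-- `k` together until it comes first.
ff-vanishes : ∀ {n k} → n ℕ.< k → ff (fromℕ n) k ≡ 0ℚ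
ff-vanishes {zero}  {suc k} _           = trans (ff-shift 0ℚ k) (*-zeroˡ (ff (0ℚ - 1ℚ) k))
ff-vanishes {suc n} {suc k} (ℕ.s≤s n<k) = trans (ff-fromℕ-suc n k)
  (trans (cong (fromℕ (suc n) *_) (ff-vanishes n<k)) (*-zeroʳ (fromℕ (suc n))))

-- Central binomial coefficients.

centralBinom-! : ∀ k → ((2 ℕ.* k) C k) ℕ.* (k ! ℕ.* k !) ≡ (2 ℕ.* k) !
centralBinom-! k = subst (λ j → ((2 ℕ.* k) C k) ℕ.* (k ! ℕ.* j !) ≡ (2 ℕ.* k) !)
  (trans (ℕ.m+n∸m≡n k (k ℕ.+ 0)) (ℕ.+-identityʳ k))
  (trans (cong (ℕ._* (k ! ℕ.* (2 ℕ.* k ∸ k) !)) (nCk≡n!/k![n-k]! k≤2k))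
         (m/n*n≡m {{k ℕ.!* (2 ℕ.* k ∸ k) !≢0}} (k![n∸k]!∣n! k≤2k)))
  where
  k≤2k : k ℕ.≤ 2 ℕ.* k
  k≤2k = ℕ.m≤m+n k (k ℕ.+ 0)

-- Multiplied by `(k + 1) · k!²`, both sides become `(2k + 2)!`.
centralBinom-sucℕ : ∀ k → ((2 ℕ.* suc k) C suc k) ℕ.* suc k ≡
                         ((2 ℕ.* k) C k) ℕ.* (2 ℕ.* (1 ℕ.+ 2 ℕ.* k))
centralBinom-sucℕ k = ℕ.*-cancelʳ-≡ _ _ (suc k ℕ.* (k ! ℕ.* k !)) {{k!²≢0}} (begin
  c′ ℕ.* suc k ℕ.* (suc k ℕ.* (k ! ℕ.* k !))
    ≡⟨ solveℕ 3 (λ c n f → c :*ℕ n :*ℕ (n :*ℕ (f :*ℕ f)) :=ℕ c :*ℕ ((n :*ℕ f) :*ℕ (n :*ℕ f))) refl c′ (suc k) (k !) ⟩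
  c′ ℕ.* (suc k ! ℕ.* suc k !)
    ≡⟨ centralBinom-! (suc k) ⟩
  (2 ℕ.* suc k) !
    ≡⟨ cong _! (ℕ.*-suc 2 k) ⟩
  (2 ℕ.+ 2 ℕ.* k) ℕ.* ((1 ℕ.+ 2 ℕ.* k) ℕ.* (2 ℕ.* k) !)
    ≡⟨ cong (λ x → (2 ℕ.+ 2 ℕ.* k) ℕ.* ((1 ℕ.+ 2 ℕ.* k) ℕ.* x)) (centralBinom-! k) ⟨
  (2 ℕ.+ 2 ℕ.* k) ℕ.* ((1 ℕ.+ 2 ℕ.* k) ℕ.* (c ℕ.* (k ! ℕ.* k !)))
    ≡⟨ solveℕ 3 (λ c k f →
         (conℕ 2 :+ℕ conℕ 2 :*ℕ k) :*ℕ ((conℕ 1 :+ℕ conℕ 2 :*ℕ k) :*ℕ (c :*ℕ (f :*ℕ f)))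
           :=ℕ c :*ℕ (conℕ 2 :*ℕ (conℕ 1 :+ℕ conℕ 2 :*ℕ k)) :*ℕ ((conℕ 1 :+ℕ k) :*ℕ (f :*ℕ f)))
         refl c k (k !) ⟩
  c ℕ.* (2 ℕ.* (1 ℕ.+ 2 ℕ.* k)) ℕ.* (suc k ℕ.* (k ! ℕ.* k !)) ∎)
  where
  open ≡-Reasoning
  open ℕ.+-*-Solver using () renaming
    (solve to solveℕ; _:*_ to _:*ℕ_; _:+_ to _:+ℕ_; _:=_ to _:=ℕ_; con to conℕ)
  c  = (2 ℕ.* k) C k
  c′ = (2 ℕ.* suc k) C suc k
  k!²≢0 : NonZero (suc k ℕ.* (k ! ℕ.* k !))
  k!²≢0 = ℕ.m*n≢0 (suc k) (k ! ℕ.* k !) {{_}} {{k ℕ.!* k !≢0}}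

centralBinom : ℕ → ℚ
centralBinom k = fromℕ ((2 ℕ.* k) C k)

centralBinom-suc : ∀ k → centralBinom (suc k) * fromℕ (suc k) ≡
                         centralBinom k * (fromℕ 2 * (1ℚ + fromℕ 2 * fromℕ k))
centralBinom-suc k = begin
  fromℕ c′ * fromℕ (suc k)                    ≡⟨ fromℕ-* c′ (suc k) ⟨
  fromℕ (c′ ℕ.* suc k)                        ≡⟨ cong fromℕ (centralBinom-sucℕ k) ⟩
  fromℕ (c ℕ.* (2 ℕ.* (1 ℕ.+ 2 ℕ.* k)))       ≡⟨ fromℕ-* c (2 ℕ.* (1 ℕ.+ 2 ℕ.* k)) ⟩
  fromℕ c * fromℕ (2 ℕ.* (1 ℕ.+ 2 ℕ.* k))     ≡⟨ cong (fromℕ c *_) (fromℕ-* 2 (1 ℕ.+ 2 ℕ.* k)) ⟩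
  fromℕ c * (fromℕ 2 * fromℕ (1 ℕ.+ 2 ℕ.* k))
    ≡⟨ cong (λ x → fromℕ c * (fromℕ 2 * x)) (trans (fromℕ-suc (2 ℕ.* k)) (cong (_+_ 1ℚ) (fromℕ-* 2 k))) ⟩
  fromℕ c * (fromℕ 2 * (1ℚ + fromℕ 2 * fromℕ k)) ∎
  where
  open ≡-Reasoning
  c  = (2 ℕ.* k) C k
  c′ = (2 ℕ.* suc k) C suc k

-- The summand under `k → k + 1` and `a → a + 1`.

T : ℚ → ℕ → ℚ
T a k = B a k * 1/4^ k

-- The weight in the last bracket does not involve `a`, so the two shifts can be carried out on
-- separate factors.
T-factors : ∀ a k →
  T a k ≡ ff a k * ff (- 1ℚ - a) k * (1/fact k * 1/fact k * centralBinom k * 1/4^ k)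
T-factors a k = solve 5 (λ x i y c q → x :* i :* (y :* i) :* c :* q := x :* y :* (i :* i :* c :* q))
  refl (ff a k) (1/fact k) (ff (- 1ℚ - a) k) (centralBinom k) (1/4^ k)

-- The weights have ratio `(2k + 1) / (2(k + 1)³)`: the factorials contribute `(k + 1)⁻²`, the
-- central binomial together with the power of 4 contributes `(2k + 1) / (2(k + 1))`.
weight-suc : ∀ k → let n = fromℕ (suc k) in
  1/fact (suc k) * 1/fact (suc k) * centralBinom (suc k) * 1/4^ (suc k) * (fromℕ 2 * (n * n * n))
    ≡ 1/fact k * 1/fact k * centralBinom k * 1/4^ k * (1ℚ + fromℕ 2 * fromℕ k)
weight-suc k = begin
  i′ * i′ * c′ * q′ * (fromℕ 2 * (n * n * n))
    ≡⟨ solve 4 (λ i c q n → i :* i :* c :* q :* (con (fromℕ 2) :* (n :* n :* n))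
         := con (fromℕ 2) :* (n :* i :* (n :* i) :* (c :* n) :* q)) refl i′ c′ q′ n ⟩
  fromℕ 2 * (n * i′ * (n * i′) * (c′ * n) * q′)
    ≡⟨ cong₂ (λ i c → fromℕ 2 * (i * i * c * q′)) (sym (1/!-suc k)) (centralBinom-suc k) ⟩
  fromℕ 2 * (i * i * (c * (fromℕ 2 * (1ℚ + fromℕ 2 * κ))) * q′)
    ≡⟨ solve 4 (λ i c κ q → con (fromℕ 2) :* (i :* i :* (c :* (con (fromℕ 2) :* (con 1ℚ :+ con (fromℕ 2) :* κ))) :* q)
         := i :* i :* c :* (con (fromℕ 4) :* q) :* (con 1ℚ :+ con (fromℕ 2) :* κ)) refl i c κ q′ ⟩
  i * i * c * (fromℕ 4 * q′) * (1ℚ + fromℕ 2 * κ)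
    ≡⟨ cong (λ q → i * i * c * q * (1ℚ + fromℕ 2 * κ)) (1/4^-suc k) ⟨
  i * i * c * 1/4^ k * (1ℚ + fromℕ 2 * κ) ∎
  where
  open ≡-Reasoning
  κ  = fromℕ k
  n  = fromℕ (suc k)
  i  = 1/fact k
  i′ = 1/fact (suc k)
  c  = centralBinom k
  c′ = centralBinom (suc k)
  q′ = 1/4^ (suc k)

-- T a k / 2(k+1)³.  In terms of it both T a (k+1) and (a+1) T (a+1) (k+1) are polynomial multiples.
K : ℚ → ℕ → ℚ
K a k = T a k * (½ * (v * v * v))
  where v = 1/ℕ (suc k)

-- Division by `2n³`, with `v` standing for `1/n`. The ring solver knows nothing of reciprocals, so
-- `n * v ≡ 1ℚ` is inserted three times by hand.
cancel-cube : ∀ n v x y → n * v ≡ 1ℚ → x * (fromℕ 2 * (n * n * n)) ≡ y → x ≡ y * (½ * (v * v * v))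
cancel-cube n v x y nv≡1 eq = begin
  x                                                        ≡⟨ solve 1 (λ x → x := x :* (con 1ℚ :* con 1ℚ :* con 1ℚ)) refl x ⟩
  x * (1ℚ * 1ℚ * 1ℚ)                                       ≡⟨ cong (λ u → x * (u * u * u)) nv≡1 ⟨
  x * (n * v * (n * v) * (n * v))
    ≡⟨ solve 3 (λ x n v → x :* (n :* v :* (n :* v) :* (n :* v))
         := x :* (con (fromℕ 2) :* (n :* n :* n)) :* (con ½ :* (v :* v :* v))) refl x n v ⟩
  x * (fromℕ 2 * (n * n * n)) * (½ * (v * v * v))          ≡⟨ cong (_* (½ * (v * v * v))) eq ⟩
  y * (½ * (v * v * v)) ∎
  where open ≡-Reasoning

T≡K : ∀ a k → let n = fromℕ (suc k) in T a k ≡ K a k * (fromℕ 2 * (n * n * n))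
T≡K a k = trans (cancel-cube n v (T a k) _ (fromℕ-1/ℕ (suc k)) refl)
  (solve 3 (λ x y z → x :* y :* z := x :* z :* y) refl (T a k) (fromℕ 2 * (n * n * n)) (½ * (v * v * v)))
  where
  n = fromℕ (suc k)
  v = 1/ℕ (suc k)

T-suc : ∀ a k → let κ = fromℕ k in
  T a (suc k) ≡ K a k * ((a - κ) * (- 1ℚ - a - κ) * (1ℚ + fromℕ 2 * κ))
T-suc a k = trans (cancel-cube n v (T a (suc k)) _ (fromℕ-1/ℕ (suc k)) (begin
  T a (suc k) * (fromℕ 2 * (n * n * n))
    ≡⟨ cong (_* (fromℕ 2 * (n * n * n))) (T-factors a (suc k)) ⟩
  x * (a - κ) * (y * (- 1ℚ - a - κ)) * w′ * (fromℕ 2 * (n * n * n))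
    ≡⟨ *-assoc (x * (a - κ) * (y * (- 1ℚ - a - κ))) w′ (fromℕ 2 * (n * n * n)) ⟩
  x * (a - κ) * (y * (- 1ℚ - a - κ)) * (w′ * (fromℕ 2 * (n * n * n)))
    ≡⟨ cong (x * (a - κ) * (y * (- 1ℚ - a - κ)) *_) (weight-suc k) ⟩
  x * (a - κ) * (y * (- 1ℚ - a - κ)) * (w * (1ℚ + fromℕ 2 * κ))
    ≡⟨ solve 6 (λ x s y t w u → x :* s :* (y :* t) :* (w :* u) := x :* y :* w :* (s :* t :* u))
         refl x (a - κ) y (- 1ℚ - a - κ) w (1ℚ + fromℕ 2 * κ) ⟩
  x * y * w * Y
    ≡⟨ cong (_* Y) (T-factors a k) ⟨
  T a k * Y ∎))
  (solve 3 (λ x y z → x :* y :* z := x :* z :* y) refl (T a k) Y (½ * (v * v * v)))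
  where
  open ≡-Reasoning
  κ  = fromℕ k
  n  = fromℕ (suc k)
  v  = 1/ℕ (suc k)
  x  = ff a k
  y  = ff (- 1ℚ - a) k
  w  = 1/fact k * 1/fact k * centralBinom k * 1/4^ k
  w′ = 1/fact (suc k) * 1/fact (suc k) * centralBinom (suc k) * 1/4^ (suc k)
  Y  = (a - κ) * (- 1ℚ - a - κ) * (1ℚ + fromℕ 2 * κ)

-- `- 1 - (a + 1)` is `(- 1 - a) - 1`, so the left side is minus the falling factorial of `- 1 - a`
-- of length `k + 2`. The sign is absorbed by the last factor, which becomes `a + 2 + k`.
ff-shift⁻ : ∀ a k → (a + 1ℚ) * ff (- 1ℚ - (a + 1ℚ)) (suc k) ≡
                    ff (- 1ℚ - a) k * (- 1ℚ - a - fromℕ k) * (a + fromℕ 2 + fromℕ k)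
ff-shift⁻ a k = begin
  (a + 1ℚ) * ff (- 1ℚ - (a + 1ℚ)) (suc k)
    ≡⟨ cong (λ y → (a + 1ℚ) * ff y (suc k)) (solve 1 (λ a → :- con 1ℚ :- (a :+ con 1ℚ) := :- con 1ℚ :- a :- con 1ℚ) refl a) ⟩
  (a + 1ℚ) * ff (- 1ℚ - a - 1ℚ) (suc k)
    ≡⟨ solve 2 (λ a f → (a :+ con 1ℚ) :* f := :- ((:- con 1ℚ :- a) :* f)) refl a (ff (- 1ℚ - a - 1ℚ) (suc k)) ⟩
  - ((- 1ℚ - a) * ff (- 1ℚ - a - 1ℚ) (suc k))
    ≡⟨ cong -_ (ff-shift (- 1ℚ - a) (suc k)) ⟨
  - (ff (- 1ℚ - a) k * (- 1ℚ - a - fromℕ k) * (- 1ℚ - a - fromℕ (suc k)))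
    ≡⟨ cong (λ n → - (ff (- 1ℚ - a) k * (- 1ℚ - a - fromℕ k) * (- 1ℚ - a - n))) (fromℕ-suc k) ⟩
  - (ff (- 1ℚ - a) k * (- 1ℚ - a - fromℕ k) * (- 1ℚ - a - (1ℚ + fromℕ k)))
    ≡⟨ solve 3 (λ f a κ → :- (f :* (:- con 1ℚ :- a :- κ) :* (:- con 1ℚ :- a :- (con 1ℚ :+ κ)))
         := f :* (:- con 1ℚ :- a :- κ) :* (a :+ con (fromℕ 2) :+ κ)) refl (ff (- 1ℚ - a) k) a (fromℕ k) ⟩
  ff (- 1ℚ - a) k * (- 1ℚ - a - fromℕ k) * (a + fromℕ 2 + fromℕ k) ∎
  where open ≡-Reasoning

-- The extra `a + 1` on the left is consumed by `ff-shift⁻`; it is what makes the right side a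
-- polynomial multiple of `K a k`.
T-shift : ∀ a k → let κ = fromℕ k in
  (a + 1ℚ) * T (a + 1ℚ) (suc k) ≡
  K a k * ((a + 1ℚ) * (- 1ℚ - a - κ) * (a + fromℕ 2 + κ) * (1ℚ + fromℕ 2 * κ))
T-shift a k = trans (cancel-cube n v ((a + 1ℚ) * T (a + 1ℚ) (suc k)) _ (fromℕ-1/ℕ (suc k)) (begin
  (a + 1ℚ) * T (a + 1ℚ) (suc k) * (fromℕ 2 * (n * n * n))
    ≡⟨ cong (λ t → (a + 1ℚ) * t * (fromℕ 2 * (n * n * n))) (T-factors (a + 1ℚ) (suc k)) ⟩
  (a + 1ℚ) * (x′ * y′ * w′) * (fromℕ 2 * (n * n * n))
    ≡⟨ solve 5 (λ b x y w n → b :* (x :* y :* w) :* n := x :* (b :* y) :* (w :* n))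
         refl (a + 1ℚ) x′ y′ w′ (fromℕ 2 * (n * n * n)) ⟩
  x′ * ((a + 1ℚ) * y′) * (w′ * (fromℕ 2 * (n * n * n)))
    ≡⟨ cong₂ _*_ (cong₂ _*_ (ff-shift⁺ a k) (ff-shift⁻ a k)) (weight-suc k) ⟩
  (a + 1ℚ) * x * (y * (- 1ℚ - a - κ) * (a + fromℕ 2 + κ)) * (w * (1ℚ + fromℕ 2 * κ))
    ≡⟨ solve 7 (λ b x y t s w u → b :* x :* (y :* t :* s) :* (w :* u) := x :* y :* w :* (b :* t :* s :* u))
         refl (a + 1ℚ) x y (- 1ℚ - a - κ) (a + fromℕ 2 + κ) w (1ℚ + fromℕ 2 * κ) ⟩
  x * y * w * Y
    ≡⟨ cong (_* Y) (T-factors a k) ⟨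
  T a k * Y ∎))
  (solve 3 (λ x y z → x :* y :* z := x :* z :* y) refl (T a k) Y (½ * (v * v * v)))
  where
  open ≡-Reasoning
  κ  = fromℕ k
  n  = fromℕ (suc k)
  v  = 1/ℕ (suc k)
  x  = ff a k
  x′ = ff (a + 1ℚ) (suc k)
  y  = ff (- 1ℚ - a) k
  y′ = ff (- 1ℚ - (a + 1ℚ)) (suc k)
  w  = 1/fact k * 1/fact k * centralBinom k * 1/4^ k
  w′ = 1/fact (suc k) * 1/fact (suc k) * centralBinom (suc k) * 1/4^ (suc k)
  Y  = (a + 1ℚ) * (- 1ℚ - a - κ) * (a + fromℕ 2 + κ) * (1ℚ + fromℕ 2 * κ)

-- Telescoping identities.

L : ℕ → ℚ → ℚ
L n a = ∑[ k < n ] (B a (toℕ k) * fromℕ (toℕ k) * 1/4^ (toℕ k))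

R : ℕ → ℚ → ℚ
R n a = ∑[ k < n ] (B a (toℕ k) * 1/4^ (toℕ k) * 1/ℕ (suc (toℕ k)))

L-suc : ∀ n a → L (suc n) a ≡ L n a + T a n * fromℕ n
L-suc n a = trans (sum-last (λ k → B a k * fromℕ k * 1/4^ k) n) (cong (_+_ (L n a))
  (solve 3 (λ x y z → x :* y :* z := x :* z :* y) refl (B a n) (fromℕ n) (1/4^ n)))

S-suc : ∀ n a → S (suc n) a ≡ S n a + T a n
S-suc n a = sum-last (T a) n

R-suc : ∀ n a → R (suc n) a ≡ R n a + T a n * 1/ℕ (suc n)
R-suc n a = sum-last (λ k → T a k * 1/ℕ (suc k)) n

-- k T_k(a) − a(a+1) T_k(a) + (a+1)² T_k(a+1) telescopes.
L-by-shift : ∀ n a → L (suc n) a ≡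
  a * (a + 1ℚ) * S (suc n) a - (a + 1ℚ) * (a + 1ℚ) * S (suc n) (a + 1ℚ)
  + (1ℚ + fromℕ 2 * fromℕ n) * (a + 1ℚ + fromℕ n) * T a n
L-by-shift zero a = solve 1 (λ a → con 0ℚ :+ con 0ℚ :=
    a :* (a :+ con 1ℚ) :* (con 1ℚ :+ con 0ℚ) :- (a :+ con 1ℚ) :* (a :+ con 1ℚ) :* (con 1ℚ :+ con 0ℚ)
    :+ (con 1ℚ :+ con (fromℕ 2) :* con 0ℚ) :* (a :+ con 1ℚ :+ con 0ℚ) :* con 1ℚ) refl a
L-by-shift (suc k) a = begin
  L (suc (suc k)) a
    ≡⟨ L-suc (suc k) a ⟩
  L (suc k) a + T a (suc k) * n
    ≡⟨ cong (_+ T a (suc k) * n) (L-by-shift k a) ⟩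
  a * (a + 1ℚ) * s - (a + 1ℚ) * (a + 1ℚ) * s₁ + (1ℚ + fromℕ 2 * κ) * (a + 1ℚ + κ) * T a k + T a (suc k) * n
    ≡⟨ cong₂ (λ t t′ → a * (a + 1ℚ) * s - (a + 1ℚ) * (a + 1ℚ) * s₁ + (1ℚ + fromℕ 2 * κ) * (a + 1ℚ + κ) * t + t′ * n)
         (T≡K a k) (T-suc a k) ⟩
  a * (a + 1ℚ) * s - (a + 1ℚ) * (a + 1ℚ) * s₁ + (1ℚ + fromℕ 2 * κ) * (a + 1ℚ + κ) * (K a k * (fromℕ 2 * (n * n * n)))
    + K a k * Y * n
    ≡⟨ cong (λ n → a * (a + 1ℚ) * s - (a + 1ℚ) * (a + 1ℚ) * s₁ + (1ℚ + fromℕ 2 * κ) * (a + 1ℚ + κ) * (K a k * (fromℕ 2 * (n * n * n)))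
         + K a k * Y * n) (fromℕ-suc k) ⟩
  a * (a + 1ℚ) * s - (a + 1ℚ) * (a + 1ℚ) * s₁ + (1ℚ + fromℕ 2 * κ) * (a + 1ℚ + κ)
    * (K a k * (fromℕ 2 * ((1ℚ + κ) * (1ℚ + κ) * (1ℚ + κ)))) + K a k * Y * (1ℚ + κ)
    -- Every new term is now a multiple of `K a k` and `n` has become `1 + κ`. What is left is a
    -- polynomial identity in which the earlier sums are opaque variables.
    ≡⟨ solve 5 (λ a s s₁ κ c →
         let b = a :+ con 1ℚ
             two = con (fromℕ 2)
             n = con 1ℚ :+ κ
             y = (a :- κ) :* (:- con 1ℚ :- a :- κ) :* (con 1ℚ :+ two :* κ)
             z = b :* (:- con 1ℚ :- a :- κ) :* (a :+ two :+ κ) :* (con 1ℚ :+ two :* κ)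
         in a :* b :* s :- b :* b :* s₁ :+ (con 1ℚ :+ two :* κ) :* (b :+ κ) :* (c :* (two :* (n :* n :* n))) :+ c :* y :* n
         := a :* b :* (s :+ c :* y) :- b :* (b :* s₁ :+ c :* z) :+ (con 1ℚ :+ two :* n) :* (b :+ n) :* (c :* y))
         refl a s s₁ κ (K a k) ⟩
  a * (a + 1ℚ) * (s + K a k * Y) - (a + 1ℚ) * ((a + 1ℚ) * s₁ + K a k * Z)
    + (1ℚ + fromℕ 2 * (1ℚ + κ)) * (a + 1ℚ + (1ℚ + κ)) * (K a k * Y)
    ≡⟨ cong (λ n → a * (a + 1ℚ) * (s + K a k * Y) - (a + 1ℚ) * ((a + 1ℚ) * s₁ + K a k * Z)
         + (1ℚ + fromℕ 2 * n) * (a + 1ℚ + n) * (K a k * Y)) (fromℕ-suc k) ⟨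
  a * (a + 1ℚ) * (s + K a k * Y) - (a + 1ℚ) * ((a + 1ℚ) * s₁ + K a k * Z)
    + (1ℚ + fromℕ 2 * n) * (a + 1ℚ + n) * (K a k * Y)
    ≡⟨ cong₂ (λ t u → a * (a + 1ℚ) * (s + t) - (a + 1ℚ) * ((a + 1ℚ) * s₁ + u)
         + (1ℚ + fromℕ 2 * n) * (a + 1ℚ + n) * t) (T-suc a k) (T-shift a k) ⟨
  a * (a + 1ℚ) * (s + T a (suc k)) - (a + 1ℚ) * ((a + 1ℚ) * s₁ + (a + 1ℚ) * T (a + 1ℚ) (suc k))
    + (1ℚ + fromℕ 2 * n) * (a + 1ℚ + n) * T a (suc k)
    ≡⟨ cong (λ u → a * (a + 1ℚ) * (s + T a (suc k)) - u + (1ℚ + fromℕ 2 * n) * (a + 1ℚ + n) * T a (suc k))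
         -- `T-shift` describes only the product `(a + 1) T (a + 1) (k + 1)`, so one factor of
         -- `(a + 1)²` was kept inside until here.
         (solve 3 (λ b s t → b :* (b :* s :+ b :* t) := b :* b :* (s :+ t)) refl (a + 1ℚ) s₁ (T (a + 1ℚ) (suc k))) ⟩
  a * (a + 1ℚ) * (s + T a (suc k)) - (a + 1ℚ) * (a + 1ℚ) * (s₁ + T (a + 1ℚ) (suc k))
    + (1ℚ + fromℕ 2 * n) * (a + 1ℚ + n) * T a (suc k)
    ≡⟨ cong₂ (λ s s₁ → a * (a + 1ℚ) * s - (a + 1ℚ) * (a + 1ℚ) * s₁ + (1ℚ + fromℕ 2 * n) * (a + 1ℚ + n) * T a (suc k))
         (S-suc (suc k) a) (S-suc (suc k) (a + 1ℚ)) ⟨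
  a * (a + 1ℚ) * S (suc (suc k)) a - (a + 1ℚ) * (a + 1ℚ) * S (suc (suc k)) (a + 1ℚ)
    + (1ℚ + fromℕ 2 * n) * (a + 1ℚ + n) * T a (suc k) ∎
  where
  open ≡-Reasoning
  κ  = fromℕ k
  n  = fromℕ (suc k)
  s  = S (suc k) a
  s₁ = S (suc k) (a + 1ℚ)
  Y  = (a - κ) * (- 1ℚ - a - κ) * (1ℚ + fromℕ 2 * κ)
  Z  = (a + 1ℚ) * (- 1ℚ - a - κ) * (a + fromℕ 2 + κ) * (1ℚ + fromℕ 2 * κ)

-- k T_k(a) − 2a(a+1) T_k(a) + a(a+1) T_k(a)/(k+1) telescopes too.
L-by-R : ∀ n a → L (suc n) a ≡
  a * (a + 1ℚ) * (fromℕ 2 * S (suc n) a - R n a)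
  + (fromℕ n * (1ℚ + fromℕ 2 * fromℕ n) - fromℕ 2 * (a * (a + 1ℚ))) * T a n
L-by-R zero a = solve 1 (λ a → con 0ℚ :+ con 0ℚ :=
    a :* (a :+ con 1ℚ) :* (con (fromℕ 2) :* (con 1ℚ :+ con 0ℚ) :- con 0ℚ)
    :+ (con 0ℚ :* (con 1ℚ :+ con (fromℕ 2) :* con 0ℚ) :- con (fromℕ 2) :* (a :* (a :+ con 1ℚ))) :* con 1ℚ) refl a
L-by-R (suc k) a = begin
  L (suc (suc k)) a
    ≡⟨ L-suc (suc k) a ⟩
  L (suc k) a + T a (suc k) * n
    ≡⟨ cong (_+ T a (suc k) * n) (L-by-R k a) ⟩
  A * (fromℕ 2 * s - r) + (κ * (1ℚ + fromℕ 2 * κ) - fromℕ 2 * A) * T a k + T a (suc k) * n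
    ≡⟨ cong₂ (λ t t′ → A * (fromℕ 2 * s - r) + (κ * (1ℚ + fromℕ 2 * κ) - fromℕ 2 * A) * t + t′ * n) (T≡K a k) (T-suc a k) ⟩
  A * (fromℕ 2 * s - r) + (κ * (1ℚ + fromℕ 2 * κ) - fromℕ 2 * A) * (K a k * (fromℕ 2 * (n * n * n))) + K a k * Y * n
    ≡⟨ cong (λ n → A * (fromℕ 2 * s - r) + (κ * (1ℚ + fromℕ 2 * κ) - fromℕ 2 * A) * (K a k * (fromℕ 2 * (n * n * n))) + K a k * Y * n) (fromℕ-suc k) ⟩
  A * (fromℕ 2 * s - r) + (κ * (1ℚ + fromℕ 2 * κ) - fromℕ 2 * A)
    * (K a k * (fromℕ 2 * ((1ℚ + κ) * (1ℚ + κ) * (1ℚ + κ)))) + K a k * Y * (1ℚ + κ)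
    ≡⟨ solve 5 (λ a s r κ c →
         let two = con (fromℕ 2)
             n = con 1ℚ :+ κ
             d = a :* (a :+ con 1ℚ)
             y = (a :- κ) :* (:- con 1ℚ :- a :- κ) :* (con 1ℚ :+ two :* κ)
         in d :* (two :* s :- r) :+ (κ :* (con 1ℚ :+ two :* κ) :- two :* d) :* (c :* (two :* (n :* n :* n))) :+ c :* y :* n
         := d :* (two :* (s :+ c :* y) :- (r :+ c :* (two :* (n :* n)))) :+ (n :* (con 1ℚ :+ two :* n) :- two :* d) :* (c :* y))
         refl a s r κ (K a k) ⟩
  A * (fromℕ 2 * (s + K a k * Y) - (r + K a k * (fromℕ 2 * ((1ℚ + κ) * (1ℚ + κ)))))
    + ((1ℚ + κ) * (1ℚ + fromℕ 2 * (1ℚ + κ)) - fromℕ 2 * A) * (K a k * Y)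
    ≡⟨ cong (λ n → A * (fromℕ 2 * (s + K a k * Y) - (r + K a k * (fromℕ 2 * (n * n))))
         + (n * (1ℚ + fromℕ 2 * n) - fromℕ 2 * A) * (K a k * Y)) (fromℕ-suc k) ⟨
  A * (fromℕ 2 * (s + K a k * Y) - (r + K a k * (fromℕ 2 * (n * n))))
    + (n * (1ℚ + fromℕ 2 * n) - fromℕ 2 * A) * (K a k * Y)
    ≡⟨ cong₂ (λ t u → A * (fromℕ 2 * (s + t) - (r + u)) + (n * (1ℚ + fromℕ 2 * n) - fromℕ 2 * A) * t) (T-suc a k) Tv≡ ⟨
  A * (fromℕ 2 * (s + T a (suc k)) - (r + T a k * v)) + (n * (1ℚ + fromℕ 2 * n) - fromℕ 2 * A) * T a (suc k)
    -- `R` lags `S` by one index: this step adds `T a (k + 1)` to `S` but `T a k / (k + 1)` to `R`.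
    ≡⟨ cong₂ (λ s r → A * (fromℕ 2 * s - r) + (n * (1ℚ + fromℕ 2 * n) - fromℕ 2 * A) * T a (suc k))
         (S-suc (suc k) a) (R-suc k a) ⟨
  A * (fromℕ 2 * S (suc (suc k)) a - R (suc k) a) + (n * (1ℚ + fromℕ 2 * n) - fromℕ 2 * A) * T a (suc k) ∎
  where
  open ≡-Reasoning
  A  = a * (a + 1ℚ)
  κ  = fromℕ k
  n  = fromℕ (suc k)
  v  = 1/ℕ (suc k)
  s  = S (suc k) a
  r  = R k a
  Y  = (a - κ) * (- 1ℚ - a - κ) * (1ℚ + fromℕ 2 * κ)
  Tv≡ : T a k * v ≡ K a k * (fromℕ 2 * (n * n))
  Tv≡ = begin
    T a k * v                                ≡⟨ cong (_* v) (T≡K a k) ⟩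
    K a k * (fromℕ 2 * (n * n * n)) * v
      ≡⟨ solve 3 (λ c n v → c :* (con (fromℕ 2) :* (n :* n :* n)) :* v := c :* (con (fromℕ 2) :* (n :* n)) :* (n :* v)) refl (K a k) n v ⟩
    K a k * (fromℕ 2 * (n * n)) * (n * v)    ≡⟨ cong (K a k * (fromℕ 2 * (n * n)) *_) (fromℕ-1/ℕ (suc k)) ⟩
    K a k * (fromℕ 2 * (n * n)) * 1ℚ         ≡⟨ *-identityʳ (K a k * (fromℕ 2 * (n * n))) ⟩
    K a k * (fromℕ 2 * (n * n)) ∎

-- This trades the powers of 4 for a falling factorial.
ff-half : ∀ k → (1ℚ + fromℕ 2 * fromℕ k) * (centralBinom k * 1/4^ k) * fromℕ (k !) ≡
                fromℕ 2 * ff (fromℕ k + ½) (suc k)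
ff-half zero    = refl
ff-half (suc k) = begin
  (1ℚ + fromℕ 2 * n) * (c′ * q′) * fromℕ (suc k !)
    ≡⟨ cong ((1ℚ + fromℕ 2 * n) * (c′ * q′) *_) (fromℕ-* (suc k) (k !)) ⟩
  (1ℚ + fromℕ 2 * n) * (c′ * q′) * (n * f)
    ≡⟨ solve 4 (λ n c q f → (con 1ℚ :+ con (fromℕ 2) :* n) :* (c :* q) :* (n :* f)
         := (con 1ℚ :+ con (fromℕ 2) :* n) :* (c :* n :* q) :* f) refl n c′ q′ f ⟩
  (1ℚ + fromℕ 2 * n) * (c′ * n * q′) * f
    ≡⟨ cong (λ x → (1ℚ + fromℕ 2 * n) * (x * q′) * f) (centralBinom-suc k) ⟩
  (1ℚ + fromℕ 2 * n) * (c * (fromℕ 2 * (1ℚ + fromℕ 2 * κ)) * q′) * f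
    -- `1 + 2n` is `2(½ + n)`. Its 2 and the 2 of the central binomial recurrence turn
    -- `1/4^ (k + 1)` into `1/4^ k`, and `½ + n` becomes the new first factor of the falling
    -- factorial.
    ≡⟨ solve 5 (λ n c κ q f → let two = con (fromℕ 2) in
         (con 1ℚ :+ two :* n) :* (c :* (two :* (con 1ℚ :+ two :* κ)) :* q) :* f
           := (con ½ :+ n) :* ((con 1ℚ :+ two :* κ) :* (c :* (con (fromℕ 4) :* q)) :* f)) refl n c κ q′ f ⟩
  (½ + n) * ((1ℚ + fromℕ 2 * κ) * (c * (fromℕ 4 * q′)) * f)
    ≡⟨ cong (λ q → (½ + n) * ((1ℚ + fromℕ 2 * κ) * (c * q) * f)) (1/4^-suc k) ⟨
  (½ + n) * ((1ℚ + fromℕ 2 * κ) * (c * 1/4^ k) * f)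
    ≡⟨ cong ((½ + n) *_) (ff-half k) ⟩
  (½ + n) * (fromℕ 2 * ff (κ + ½) (suc k))
    ≡⟨ solve 2 (λ n x → (con ½ :+ n) :* (con (fromℕ 2) :* x) := con (fromℕ 2) :* ((n :+ con ½) :* x)) refl n (ff (κ + ½) (suc k)) ⟩
  fromℕ 2 * ((n + ½) * ff (κ + ½) (suc k))
    ≡⟨ cong (λ y → fromℕ 2 * ((n + ½) * ff y (suc k)))
         (trans (solve 1 (λ κ → κ :+ con ½ := con 1ℚ :+ κ :+ con ½ :- con 1ℚ) refl κ)
                (cong (λ n → n + ½ - 1ℚ) (sym (fromℕ-suc k)))) ⟩
  fromℕ 2 * ((n + ½) * ff (n + ½ - 1ℚ) (suc k))
    ≡⟨ cong (fromℕ 2 *_) (ff-shift (n + ½) (suc k)) ⟨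
  fromℕ 2 * ff (n + ½) (suc (suc k)) ∎
  where
  open ≡-Reasoning
  κ  = fromℕ k
  n  = fromℕ (suc k)
  f  = fromℕ (k !)
  c  = centralBinom k
  c′ = centralBinom (suc k)
  q′ = 1/4^ (suc k)

-- Integrality and units at p.

module _ {p : ℕ} (p-prime : Prime p) where
  open AtPrime p-prime

  -- Unlike x ∈ℤₚ, which unfolds, this lets x be inferred.
  record Integral (x : ℚ) : Set where
    constructor integral
    field ∈ℤₚ : x ∈ℤₚ

  open Integral

  private instance
    p≢0 : NonZero p
    p≢0 = prime⇒nonZero p-prime

  p∤1 : p ∤ 1
  p∤1 p∣1 = ¬prime[1] (subst Prime (∣1⇒≡1 p∣1) p-prime)

  p∤* : ∀ {m n} → p ∤ m → p ∤ n → p ∤ m ℕ.* n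
  p∤* p∤m p∤n p∣mn with euclidsLemma _ _ p-prime p∣mn
  ... | inj₁ p∣m = p∤m p∣m
  ... | inj₂ p∣n = p∤n p∣n

  p∤! : ∀ {k} → k ℕ.< p → p ∤ k !
  p∤! {zero}  _   = p∤1
  p∤! {suc k} k<p = p∤* (>⇒∤ k<p) (p∤! (ℕ.<-trans (ℕ.n<1+n k) k<p))

  p∤^ : ∀ {m} k → p ∤ m → p ∤ m ^ k
  p∤^ zero    p∤m = p∤1
  p∤^ (suc k) p∤m = p∤* p∤m (p∤^ k p∤m)

  -- `d` is the reduced denominator times a gcd, so a prime dividing the former divides `d`.
  /-integral : ∀ i d .{{_ : NonZero d}} → p ∤ d → Integral (i / d)
  /-integral i d p∤d = integral λ p∣ →
    p∤d (∣-trans p∣ (subst (↧ₙ (i / d) ∣_) eq (m∣m*n ℤ.∣ g ∣)))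
    where
    g  = gcd i (+ d)
    eq : ↧ₙ (i / d) ℕ.* ℤ.∣ g ∣ ≡ d
    eq = trans (sym (ℤ.abs-* (↧ (i / d)) g)) (cong ℤ.∣_∣ (↧-/ i d))

  +-integral : ∀ {x y} → Integral x → Integral y → Integral (x + y)
  +-integral {x@record{}} {y@record{}} (integral p∤x) (integral p∤y) =
    /-integral (↥ x ℤ.* ↧ y ℤ.+ ↥ y ℤ.* ↧ x) (↧ₙ x ℕ.* ↧ₙ y) (p∤* p∤x p∤y)

  *-integral : ∀ {x y} → Integral x → Integral y → Integral (x * y)
  *-integral {x@record{}} {y@record{}} (integral p∤x) (integral p∤y) =
    /-integral (↥ x ℤ.* ↥ y) (↧ₙ x ℕ.* ↧ₙ y) (p∤* p∤x p∤y)

  neg-integral : ∀ {x} → Integral x → Integral (- x)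
  -- Negation is defined by cases on the numerator; in each case the denominator is unchanged by
  -- computation.
  neg-integral {mkℚ (+ 0)    _ _} (integral p∤x) = integral p∤x
  neg-integral {mkℚ ℤ.+[1+ _ ] _ _} (integral p∤x) = integral p∤x
  neg-integral {mkℚ ℤ.-[1+ _ ] _ _} (integral p∤x) = integral p∤x

  minus-integral : ∀ {x y} → Integral x → Integral y → Integral (x - y)
  minus-integral hx hy = +-integral hx (neg-integral hy)

  fromℕ-integral : ∀ n → Integral (fromℕ n)
  fromℕ-integral n = /-integral (+ n) 1 p∤1

  1/ℕ-integral : ∀ {n} .{{_ : NonZero n}} → p ∤ n → Integral (1/ℕ n)
  1/ℕ-integral {n} = /-integral (+ 1) n

  sum-integral : ∀ {f : ℕ → ℚ} n → (∀ k → k ℕ.< n → Integral (f k)) → Integral (∑[ k < n ] f (toℕ k))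
  sum-integral zero    h = fromℕ-integral 0
  sum-integral {f} (suc n) h = +-integral (h 0 ℕ.z<s)
    (sum-integral {λ k → f (suc k)} n λ k k<n → h (suc k) (ℕ.s<s k<n))

  ff-integral : ∀ {x} k → Integral x → Integral (ff x k)
  ff-integral zero    hx = fromℕ-integral 1
  ff-integral (suc k) hx = *-integral (ff-integral k hx) (minus-integral hx (fromℕ-integral k))

  P : ℚ
  P = fromℕ p

  fromℕ-p^-suc : ∀ n → fromℕ (p ^ suc n) ≡ P * fromℕ (p ^ n)
  fromℕ-p^-suc n = fromℕ-* p (p ^ n)

  fromℕ-1/p^ : ∀ n → fromℕ (p ^ n) * 1/p^ n ≡ 1ℚ
  fromℕ-1/p^ n = fromℕ-1/ℕ (p ^ n) {{ℕ.m^n≢0 p n}}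

  P*1/p≡1 : P * 1/p^ 1 ≡ 1ℚ
  P*1/p≡1 = subst (λ n → fromℕ n * 1/p^ 1 ≡ 1ℚ) (ℕ.^-identityʳ p) (fromℕ-1/p^ 1)

  -- With the cofactor `z` explicit, all earlier work on congruences consists of equations in ℚ.
  mod-intro : ∀ n {x y z} → Integral x → Integral y → Integral z →
              x ≡ y + fromℕ (p ^ n) * z → x ≡ y [modp^ n ]
  mod-intro n {x} {y} {z} hx hy hz eq = congruent (∈ℤₚ hx) (∈ℤₚ hy) (∈ℤₚ (subst Integral (sym quot≡z) hz))
    where
    open ≡-Reasoning
    q = fromℕ (p ^ n)
    quot≡z : (x - y) * 1/p^ n ≡ z
    quot≡z = begin
      (x - y) * 1/p^ n            ≡⟨ cong (λ x → (x - y) * 1/p^ n) eq ⟩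
      (y + q * z - y) * 1/p^ n
        ≡⟨ solve 4 (λ y q z i → (y :+ q :* z :- y) :* i := z :* (q :* i)) refl y q z (1/p^ n) ⟩
      z * (q * 1/p^ n)            ≡⟨ cong (z *_) (fromℕ-1/p^ n) ⟩
      z * 1ℚ                      ≡⟨ *-identityʳ z ⟩
      z ∎

  p∣numerator : ∀ {x} → Integral x → p ∣ ℤ.∣ ↥ x ∣ → Integral (x * 1/p^ 1)
  p∣numerator {x} (integral p∤x) p∣↥ =
    let ℤ.divides q ↥≡q*p = ℤ.∣ᵤ⇒∣ {+ p} {↥ x} p∣↥
    in subst Integral (sym (begin
    x * 1/p^ 1                              ≡⟨ cong (_* 1/p^ 1) (↥p/↧p≡p x) ⟨
    (↥ x / ↧ₙ x) * 1/p^ 1                   ≡⟨ cong (λ i → (i / ↧ₙ x) * 1/p^ 1) ↥≡q*p ⟩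
    -- `P` is a fraction over 1, so the denominator is padded to `↧ₙ x * 1` to fit the product rule.
    ((q ℤ.* + p) / ↧ₙ x) * 1/p^ 1           ≡⟨ cong (_* 1/p^ 1) (/-cong {q ℤ.* + p} {{_}} {{↧*1≢0}} refl (sym (ℕ.*-identityʳ (↧ₙ x)))) ⟩
    ((q ℤ.* + p) / (↧ₙ x ℕ.* 1)) {{↧*1≢0}} * 1/p^ 1
                                            ≡⟨ cong (_* 1/p^ 1) (/-*-/ q (↧ₙ x) (+ p) 1 {{_}} {{_}} {{↧*1≢0}}) ⟨
    (q / ↧ₙ x) * P * 1/p^ 1                 ≡⟨ *-assoc (q / ↧ₙ x) P (1/p^ 1) ⟩
    (q / ↧ₙ x) * (P * 1/p^ 1)               ≡⟨ cong ((q / ↧ₙ x) *_) P*1/p≡1 ⟩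
    (q / ↧ₙ x) * 1ℚ                         ≡⟨ *-identityʳ (q / ↧ₙ x) ⟩
    q / ↧ₙ x ∎)) (/-integral q (↧ₙ x) p∤x)
    where
    open ≡-Reasoning
    ↧*1≢0 : NonZero (↧ₙ x ℕ.* 1)
    ↧*1≢0 = ℕ.m*n≢0 (↧ₙ x) 1

  -- If `x / p` is not integral, p does not divide the numerator of `x`, which is up to sign the
  -- denominator of `1/ x`. The split by sign lets `1/_` reduce.
  unit⁻¹ : ∀ {x} → Integral x → ¬ Integral (x * 1/p^ 1) → ∃ λ y → Integral y × x * y ≡ 1ℚ
  unit⁻¹ {mkℚ (+ 0) _ _} hx x∉p = ⊥-elim (x∉p (p∣numerator hx (p ∣0)))
  unit⁻¹ {x@(mkℚ ℤ.+[1+ _ ] _ _)} hx x∉p = 1/ x , integral (λ p∣ → x∉p (p∣numerator hx p∣)) , *-inverseʳ x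
  unit⁻¹ {x@(mkℚ ℤ.-[1+ _ ] _ _)} hx x∉p = 1/ x , integral (λ p∣ → x∉p (p∣numerator hx p∣)) , *-inverseʳ x

  -- The inverse `v` of `b` is integral, so dividing by `b` leaves the error a multiple of p⁴.
  cancel-unit : ∀ {b v g α} → b * v ≡ 1ℚ → Integral v →
    (∃ λ z → Integral z × b * g ≡ P * P * P * (α + P * z)) →
    ∃ λ z → Integral z × g ≡ α * v * fromℕ (p ^ 3) + fromℕ (p ^ 4) * z
  cancel-unit {b} {v} {g} {α} bv≡1 hv (z , hz , eq) = z * v , *-integral hz hv , (begin
    g
      ≡⟨ *-identityˡ g ⟨
    1ℚ * g
      ≡⟨ cong (_* g) bv≡1 ⟨
    b * v * g
      ≡⟨ solve 3 (λ b v g → b :* v :* g := b :* g :* v) refl b v g ⟩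
    b * g * v
      ≡⟨ cong (_* v) eq ⟩
    P * P * P * (α + P * z) * v
      ≡⟨ solve 4 (λ p α z v → p :* p :* p :* (α :+ p :* z) :* v
           := α :* v :* (p :* (p :* (p :* con 1ℚ))) :+ p :* (p :* (p :* (p :* con 1ℚ))) :* (z :* v))
           refl P α z v ⟩
    α * v * (P * (P * (P * 1ℚ))) + P * (P * (P * (P * 1ℚ))) * (z * v)
      ≡⟨ cong (λ x → α * v * x + P * x * (z * v)) p³≡ ⟨
    α * v * fromℕ (p ^ 3) + P * fromℕ (p ^ 3) * (z * v)
      ≡⟨ cong (λ x → α * v * fromℕ (p ^ 3) + x * (z * v)) (fromℕ-p^-suc 3) ⟨
    α * v * fromℕ (p ^ 3) + fromℕ (p ^ 4) * (z * v) ∎)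
    where
    open ≡-Reasoning
    p³≡ : fromℕ (p ^ 3) ≡ P * (P * (P * 1ℚ))
    p³≡ = trans (fromℕ-p^-suc 2) (cong (P *_)
      (trans (fromℕ-p^-suc 1) (cong (P *_) (fromℕ-p^-suc 0))))

  -- A falling factorial is a polynomial with integer coefficients, hence respects congruence modulo
  -- p.
  ff-cong : ∀ k {x t} → Integral x → Integral t → ∃ λ z → Integral z × ff (x + P * t) k ≡ ff x k + P * z
  ff-cong zero {x} {t} hx ht = 0ℚ , fromℕ-integral 0 , solve 1 (λ p → con 1ℚ := con 1ℚ :+ p :* con 0ℚ) refl P
  ff-cong (suc k) {x} {t} hx ht = let z , hz , eq = ff-cong k hx ht in
    ff x k * t + z * (x + P * t - fromℕ k) ,
    +-integral (*-integral (ff-integral k hx) ht)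
      (*-integral hz (minus-integral (+-integral hx (*-integral (fromℕ-integral p) ht)) (fromℕ-integral k))) ,
    trans (cong (_* (x + P * t - fromℕ k)) eq)
      (solve 6 (λ f p z x t k → (f :+ p :* z) :* (x :+ p :* t :- k)
        := f :* (x :- k) :+ p :* (f :* t :+ z :* (x :+ p :* t :- k))) refl (ff x k) P z x t (fromℕ k))

  module _ (p∤2 : p ∤ 2) where

    -- `k < p` makes `k !` a unit at p, and p odd makes `4 ^ k` one.
    T-integral : ∀ {a} k → k ℕ.< p → Integral a → Integral (T a k)
    T-integral {a} k k<p ha = *-integral
      (*-integral (*-integral (binom-integral ha) (binom-integral (minus-integral (neg-integral (fromℕ-integral 1)) ha)))
        (fromℕ-integral ((2 ℕ.* k) C k)))
      (1/ℕ-integral {{ℕ.m^n≢0 4 k}} (p∤^ k (p∤* p∤2 p∤2)))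
      where
      binom-integral : ∀ {x} → Integral x → Integral (binom x k)
      binom-integral hx = *-integral (ff-integral k hx) (1/ℕ-integral {{k ℕ.!≢0}} (p∤! k<p))

    S-integral : ∀ {a} → Integral a → Integral (S p a)
    S-integral ha = sum-integral p λ k k<p → T-integral k k<p ha

    L-integral : ∀ {a} → Integral a → Integral (L p a)
    L-integral {a} ha = sum-integral p λ k k<p →
      subst Integral (solve 3 (λ x y z → x :* z :* y := x :* y :* z) refl (B a k) (fromℕ k) (1/4^ k))
        (*-integral (T-integral k k<p ha) (fromℕ-integral k))

    -- All denominators `k + 1 ≤ m` are below p; a term at `k = p - 1` would have denominator p.
    R-integral : ∀ {m a} → m ℕ.< p → Integral a → Integral (R m a)
    R-integral {m} m<p ha = sum-integral m λ k k<m →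
      *-integral (T-integral k (ℕ.<-trans k<m m<p) ha) (1/ℕ-integral (>⇒∤ (ℕ.≤-<-trans k<m m<p)))

-- Falling factorials over a complete residue system.

module _ {m : ℕ} (p-prime : Prime (suc m)) where
  open AtPrime p-prime

  private
    p = suc m
    Int = Integral p-prime
    P′ = P p-prime

  -- Induction on s: passing from x to x + 1 changes ff x p by p ff x (p-1), and p divides ff x (p-1)
  -- as long as s < p - 1.
  ff-p : ∀ s {y} → s ℕ.≤ m → Int y →
         ∃ λ z → Int z × ff (fromℕ s + P′ * y) p ≡ P′ * (y * fromℕ (m !) + P′ * z)
  ff-p zero {y} _ hy =
    let z , hz , eq = ff-cong p-prime m {fromℕ m} {y - 1ℚ} (fromℕ-integral p-prime m)
                        (minus-integral p-prime hy (fromℕ-integral p-prime 1))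
    in y * z , *-integral p-prime hy hz , (begin
    ff (0ℚ + P′ * y) p                                    ≡⟨ ff-shift (0ℚ + P′ * y) m ⟩
    (0ℚ + P′ * y) * ff (0ℚ + P′ * y - 1ℚ) m               ≡⟨ cong (λ x → (0ℚ + P′ * y) * ff x m) lower ⟩
    (0ℚ + P′ * y) * ff (fromℕ m + P′ * (y - 1ℚ)) m        ≡⟨ cong ((0ℚ + P′ * y) *_) eq ⟩
    (0ℚ + P′ * y) * (ff (fromℕ m) m + P′ * z)             ≡⟨ cong (λ f → (0ℚ + P′ * y) * (f + P′ * z)) (ff-! m) ⟩
    (0ℚ + P′ * y) * (fromℕ (m !) + P′ * z)
      ≡⟨ solve 4 (λ p y f z → (con 0ℚ :+ p :* y) :* (f :+ p :* z) := p :* (y :* f :+ p :* (y :* z))) refl P′ y (fromℕ (m !)) z ⟩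
    P′ * (y * fromℕ (m !) + P′ * (y * z)) ∎)
    where
    open ≡-Reasoning
    -- As `P′` is `1 + m`, the argument `p y - 1` is `m` plus a multiple of p. The first factor
    -- `p y` already supplies one p, so the other `m` factors matter only modulo p, where they give
    -- `m !`.
    lower : 0ℚ + P′ * y - 1ℚ ≡ fromℕ m + P′ * (y - 1ℚ)
    lower = begin
      0ℚ + P′ * y - 1ℚ
        ≡⟨ cong (λ x → 0ℚ + x * y - 1ℚ) (fromℕ-suc m) ⟩
      0ℚ + (1ℚ + fromℕ m) * y - 1ℚ
        ≡⟨ solve 2 (λ m y → con 0ℚ :+ (con 1ℚ :+ m) :* y :- con 1ℚ := m :+ (con 1ℚ :+ m) :* (y :- con 1ℚ)) refl (fromℕ m) y ⟩
      fromℕ m + (1ℚ + fromℕ m) * (y - 1ℚ)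
        ≡⟨ cong (λ x → fromℕ m + x * (y - 1ℚ)) (fromℕ-suc m) ⟨
      fromℕ m + P′ * (y - 1ℚ) ∎
  ff-p (suc s) {y} s<m hy =
    let z , hz , eq  = ff-p s (ℕ.<⇒≤ s<m) hy
        w , hw , eq′ = ff-cong p-prime m {fromℕ s} {y} (fromℕ-integral p-prime s) hy
    in z + w , +-integral p-prime hz hw , (begin
    ff (fromℕ (suc s) + P′ * y) p
      ≡⟨ cong (λ x → ff x p) (trans (cong (_+ P′ * y) (fromℕ-suc s))
           (solve 2 (λ s t → con 1ℚ :+ s :+ t := s :+ t :+ con 1ℚ) refl (fromℕ s) (P′ * y))) ⟩
    ff (x + 1ℚ) p
      ≡⟨ ff-shift⁺ x m ⟩
    (x + 1ℚ) * ff x m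
      -- `x + 1` is `(x - m) + p`: the first part is the last factor of `ff x p`, the second leaves
      -- p times `ff x m`.
      ≡⟨ solve 3 (λ x f m → (x :+ con 1ℚ) :* f := f :* (x :- m) :+ (con 1ℚ :+ m) :* f) refl x (ff x m) (fromℕ m) ⟩
    ff x p + (1ℚ + fromℕ m) * ff x m
      ≡⟨ cong₂ (λ u v → u + v * ff x m) eq (sym (fromℕ-suc m)) ⟩
    P′ * (y * fromℕ (m !) + P′ * z) + P′ * ff x m
      ≡⟨ cong (λ f → P′ * (y * fromℕ (m !) + P′ * z) + P′ * f) (trans eq′ (cong (_+ P′ * w) (ff-vanishes s<m))) ⟩
    P′ * (y * fromℕ (m !) + P′ * z) + P′ * (0ℚ + P′ * w)
      ≡⟨ solve 4 (λ p u z w → p :* (u :+ p :* z) :+ p :* (con 0ℚ :+ p :* w) := p :* (u :+ p :* (z :+ w)))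
           refl P′ (y * fromℕ (m !)) z w ⟩
    P′ * (y * fromℕ (m !) + P′ * (z + w)) ∎)
    where
    open ≡-Reasoning
    x = fromℕ s + P′ * y

  infix 4 _≡p*_[modp²]
  -- The witness is explicit and one p is factored out, so a product of three such equations is p³
  -- times the product of the leading terms, up to a multiple of p⁴.
  _≡p*_[modp²] : ℚ → ℚ → Set
  x ≡p* y [modp²] = ∃ λ z → Int z × x ≡ P′ * (y + P′ * z)

  ff-p/fact : ∀ s {x y} → s ℕ.≤ m → Int y → x ≡ fromℕ s + P′ * y →
              ff x p * 1/fact m ≡p* y [modp²]
  ff-p/fact s {x} {y} s≤m hy refl = let z , hz , eq = ff-p s s≤m hy in
    z * i , *-integral p-prime hz (1/ℕ-integral p-prime {{m ℕ.!≢0}} (p∤! p-prime (ℕ.n<1+n m))) , (begin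
    ff x p * i
      ≡⟨ cong (_* i) eq ⟩
    P′ * (y * fromℕ (m !) + P′ * z) * i
      ≡⟨ solve 5 (λ p y f z i → p :* (y :* f :+ p :* z) :* i := p :* (y :* (f :* i) :+ p :* (z :* i))) refl P′ y (fromℕ (m !)) z i ⟩
    P′ * (y * (fromℕ (m !) * i) + P′ * (z * i))
      ≡⟨ cong (λ u → P′ * (y * u + P′ * (z * i))) (fromℕ-1/ℕ (m !) {{m ℕ.!≢0}}) ⟩
    P′ * (y * 1ℚ + P′ * (z * i))
      ≡⟨ cong (λ u → P′ * (u + P′ * (z * i))) (*-identityʳ y) ⟩
    P′ * (y + P′ * (z * i)) ∎)
    where
    open ≡-Reasoning
    i = 1/fact m

-- For `n = p - 1` this supplies `(p - 1) / 2`, the residue of `n + ½` modulo p.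
half : ∀ n → 2 ∤ suc n → ∃ λ s → n ≡ s ℕ.+ s
half zero          _  = 0 , refl
half (suc zero)    2∤ = ⊥-elim (2∤ ∣-refl)
half (suc (suc n)) 2∤ with half n (λ 2∣ → 2∤ (∣m∣n⇒∣m+n ∣-refl 2∣))
... | s , eq = suc s , cong suc (trans (cong suc eq) (sym (ℕ.+-suc s s)))

-- The boundary terms and the two congruences.

module _ {m : ℕ} (p-prime : Prime (suc m)) (2∤p : 2 ∤ suc m) {a : ℚ} where
  open AtPrime p-prime

  private
    p = suc m
    Int = Integral p-prime
    P′ = P p-prime
    M = fromℕ m

    infixl 6 _+ᴵ_
    infixl 7 _*ᴵ_
    _+ᴵ_ : ∀ {x y} → Int x → Int y → Int (x + y)
    _+ᴵ_ = +-integral p-prime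
    _*ᴵ_ : ∀ {x y} → Int x → Int y → Int (x * y)
    _*ᴵ_ = *-integral p-prime
    negᴵ : ∀ {x} → Int x → Int (- x)
    negᴵ = neg-integral p-prime
    ℕᴵ : ∀ n → Int (fromℕ n)
    ℕᴵ = fromℕ-integral p-prime

  p∤2 : p ∤ 2
  p∤2 p∣2 with prime⇒irreducible prime[2] p∣2
  ... | inj₁ p≡1 = ¬prime[1] (subst Prime p≡1 p-prime)
  ... | inj₂ p≡2 = 2∤p (subst (2 ∣_) (sym p≡2) ∣-refl)

  -- The leftover of `L-by-shift` at `n = m`; its first two factors are `2p - 1` and `a + p`.
  boundary : ℚ
  boundary = (1ℚ + fromℕ 2 * M) * (a + 1ℚ + M) * T a m

  -- Three complete residue systems: the factors of (a+1) C(a,p-1), of C(-1-a,p-1) (a+p), and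
  -- of (2p-1) C(2p-2,p-1)/4^(p-1).
  boundary-factors :
    (a + 1ℚ) * boundary ≡ - (ff (a + 1ℚ) p * 1/fact m * (ff (- 1ℚ - a) p * 1/fact m)
                             * (fromℕ 2 * (ff (M + ½) p * 1/fact m)))
  boundary-factors = begin
    (a + 1ℚ) * ((1ℚ + fromℕ 2 * M) * (a + 1ℚ + M) * T a m)
      ≡⟨ cong (λ t → (a + 1ℚ) * ((1ℚ + fromℕ 2 * M) * (a + 1ℚ + M) * t)) (T-factors a m) ⟩
    (a + 1ℚ) * ((1ℚ + fromℕ 2 * M) * (a + 1ℚ + M) * (x * y * (i * i * c * q)))
      -- `a + 1` opens `ff (a + 1ℚ) p`, and `a + 1 + M` is minus the last factor of
      -- `ff (- 1ℚ - a) p`, hence the sign. The trailing `1ℚ` is a slot for `m ! * 1/fact m`, whose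
      -- factorial `ff-half` consumes.
      ≡⟨ solve 7 (λ a M x y i c q →
           (a :+ con 1ℚ) :* ((con 1ℚ :+ con (fromℕ 2) :* M) :* (a :+ con 1ℚ :+ M) :* (x :* y :* (i :* i :* c :* q)))
           := :- ((a :+ con 1ℚ) :* x :* i :* (y :* (:- con 1ℚ :- a :- M) :* i) :* ((con 1ℚ :+ con (fromℕ 2) :* M) :* (c :* q) :* con 1ℚ)))
           refl a M x y i c q ⟩
    - ((a + 1ℚ) * x * i * (y * (- 1ℚ - a - M) * i) * ((1ℚ + fromℕ 2 * M) * (c * q) * 1ℚ))
      ≡⟨ cong₂ (λ u v → - (u * i * (y * (- 1ℚ - a - M) * i) * ((1ℚ + fromℕ 2 * M) * (c * q) * v)))
           (ff-shift⁺ a m) (fromℕ-1/ℕ (m !) {{m ℕ.!≢0}}) ⟨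
    - (ff (a + 1ℚ) p * i * (ff (- 1ℚ - a) p * i) * ((1ℚ + fromℕ 2 * M) * (c * q) * (f * i)))
      ≡⟨ cong (λ u → - (ff (a + 1ℚ) p * i * (ff (- 1ℚ - a) p * i) * u))
           (trans (sym (*-assoc ((1ℚ + fromℕ 2 * M) * (c * q)) f i))
           (trans (cong (_* i) (ff-half m)) (*-assoc (fromℕ 2) (ff (M + ½) p) i))) ⟩
    - (ff (a + 1ℚ) p * i * (ff (- 1ℚ - a) p * i) * (fromℕ 2 * (ff (M + ½) p * i))) ∎
    where
    open ≡-Reasoning
    x = ff a m
    y = ff (- 1ℚ - a) m
    i = 1/fact m
    f = fromℕ (m !)
    c = centralBinom m
    q = 1/4^ m

  boundary-combine : ∀ {a′} → Int a′ →
    _≡p*_[modp²] p-prime (ff (a + 1ℚ) p * 1/fact m) a′ →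
    _≡p*_[modp²] p-prime (ff (- 1ℚ - a) p * 1/fact m) (- (a′ + 1ℚ)) →
    _≡p*_[modp²] p-prime (ff (M + ½) p * 1/fact m) ½ →
    ∃ λ z → Int z × (a + 1ℚ) * boundary ≡ P′ * P′ * P′ * (a′ * (a′ + 1ℚ) + P′ * z)
  boundary-combine {a′} ha′ (z₁ , hz₁ , eq₁) (z₂ , hz₂ , eq₂) (z₃ , hz₃ , eq₃) =
    z ,
    (hz₁ *ᴵ (ha′ +ᴵ ℕᴵ 1) +ᴵ negᴵ (ha′ *ᴵ hz₂) +ᴵ negᴵ (ℕᴵ p *ᴵ hz₁ *ᴵ hz₂)) *ᴵ (ℕᴵ 1 +ᴵ ℕᴵ 2 *ᴵ (ℕᴵ p *ᴵ hz₃))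
      +ᴵ ℕᴵ 2 *ᴵ (ha′ *ᴵ (ha′ +ᴵ ℕᴵ 1) *ᴵ hz₃) ,
    (begin
    (a + 1ℚ) * boundary
      ≡⟨ boundary-factors ⟩
    - (ff (a + 1ℚ) p * 1/fact m * (ff (- 1ℚ - a) p * 1/fact m) * (fromℕ 2 * (ff (M + ½) p * 1/fact m)))
      ≡⟨ cong₂ (λ u v → - (u * (fromℕ 2 * v))) (cong₂ _*_ eq₁ eq₂) eq₃ ⟩
    - (P′ * (a′ + P′ * z₁) * (P′ * (- (a′ + 1ℚ) + P′ * z₂)) * (fromℕ 2 * (P′ * (½ + P′ * z₃))))
      -- The outer sign cancels that of `- (a′ + 1)`, and `2 * ½` is 1; `z` collects the terms with
      -- a further factor p.
      ≡⟨ solve 5 (λ p α z₁ z₂ z₃ →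
           let two = con (fromℕ 2)
               β = α :+ con 1ℚ
           in :- (p :* (α :+ p :* z₁) :* (p :* (:- β :+ p :* z₂)) :* (two :* (p :* (con ½ :+ p :* z₃))))
           := p :* p :* p :* (α :* β :+ p :* ((z₁ :* β :+ :- (α :* z₂) :+ :- (p :* z₁ :* z₂)) :* (con 1ℚ :+ two :* (p :* z₃))
                :+ two :* (α :* β :* z₃)))) refl P′ a′ z₁ z₂ z₃ ⟩
    P′ * P′ * P′ * (a′ * (a′ + 1ℚ) + P′ * z) ∎)
    where
    open ≡-Reasoning
    z = (z₁ * (a′ + 1ℚ) + - (a′ * z₂) + - (P′ * z₁ * z₂)) * (1ℚ + fromℕ 2 * (P′ * z₃))
        + fromℕ 2 * (a′ * (a′ + 1ℚ) * z₃)

  -- Modulo p, `a + 1`, `- 1 - a` and `m + ½` have residues `r + 1`, `m - r` and `(p - 1) / 2`;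
  -- `r < m` keeps the first of them below p.
  boundary-mod : ∀ {r a′} → r ℕ.< m → Int a′ → a ≡ fromℕ r + P′ * a′ →
    ∃ λ z → Int z × (a + 1ℚ) * boundary ≡ P′ * P′ * P′ * (a′ * (a′ + 1ℚ) + P′ * z)
  boundary-mod {r} {a′} r<m ha′ a≡ = boundary-combine ha′
    (ff-p/fact p-prime (suc r) r<m ha′ residue₁)
    (ff-p/fact p-prime (m ∸ r) (ℕ.m∸n≤m m r) (negᴵ (ha′ +ᴵ ℕᴵ 1)) residue₂)
    (ff-p/fact p-prime s s≤m (1/ℕ-integral p-prime {2} p∤2) residue₃)
    where
    open ≡-Reasoning
    s = proj₁ (half m 2∤p)
    m≡2s = proj₂ (half m 2∤p)
    s≤m : s ℕ.≤ m
    s≤m = subst (s ℕ.≤_) (sym m≡2s) (ℕ.m≤m+n s s)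
    residue₁ : a + 1ℚ ≡ fromℕ (suc r) + P′ * a′
    residue₁ = begin
      a + 1ℚ                          ≡⟨ cong (_+ 1ℚ) a≡ ⟩
      fromℕ r + P′ * a′ + 1ℚ          ≡⟨ solve 2 (λ r t → r :+ t :+ con 1ℚ := con 1ℚ :+ r :+ t) refl (fromℕ r) (P′ * a′) ⟩
      1ℚ + fromℕ r + P′ * a′          ≡⟨ cong (_+ P′ * a′) (fromℕ-suc r) ⟨
      fromℕ (suc r) + P′ * a′ ∎
    residue₂ : - 1ℚ - a ≡ fromℕ (m ∸ r) + P′ * - (a′ + 1ℚ)
    residue₂ = begin
      - 1ℚ - a
        ≡⟨ cong (λ x → - 1ℚ - x) a≡ ⟩
      - 1ℚ - (fromℕ r + P′ * a′)
        ≡⟨ cong (λ x → - 1ℚ - (fromℕ r + x * a′)) P≡ ⟩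
      - 1ℚ - (fromℕ r + (1ℚ + (d + fromℕ r)) * a′)
        ≡⟨ solve 3 (λ r d a → :- con 1ℚ :- (r :+ (con 1ℚ :+ (d :+ r)) :* a)
             := d :+ (con 1ℚ :+ (d :+ r)) :* (:- (a :+ con 1ℚ))) refl (fromℕ r) d a′ ⟩
      d + (1ℚ + (d + fromℕ r)) * - (a′ + 1ℚ)
        ≡⟨ cong (λ x → d + x * - (a′ + 1ℚ)) P≡ ⟨
      d + P′ * - (a′ + 1ℚ) ∎
      where
      d = fromℕ (m ∸ r)
      P≡ : P′ ≡ 1ℚ + (d + fromℕ r)
      P≡ = trans (fromℕ-suc m) (cong (_+_ 1ℚ)
        (trans (cong fromℕ (sym (ℕ.m∸n+n≡m (ℕ.<⇒≤ r<m)))) (fromℕ-+ (m ∸ r) r)))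
    residue₃ : M + ½ ≡ fromℕ s + P′ * ½
    residue₃ = begin
      M + ½
        ≡⟨ cong (_+ ½) M≡ ⟩
      fromℕ s + fromℕ s + ½
        ≡⟨ solve 1 (λ s → s :+ s :+ con ½ := s :+ (con 1ℚ :+ (s :+ s)) :* con ½) refl (fromℕ s) ⟩
      fromℕ s + (1ℚ + (fromℕ s + fromℕ s)) * ½
        ≡⟨ cong (λ x → fromℕ s + (1ℚ + x) * ½) M≡ ⟨
      fromℕ s + (1ℚ + M) * ½
        ≡⟨ cong (λ x → fromℕ s + x * ½) (fromℕ-suc m) ⟨
      fromℕ s + P′ * ½ ∎
      where
      M≡ : M ≡ fromℕ s + fromℕ s
      M≡ = trans (cong fromℕ m≡2s) (fromℕ-+ s s)

  module _ (a∈ℤₚ : a ∈ℤₚ) (a≢-1 : ¬ (a ≡ - 1ℚ [modp^ 1 ])) where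

    private
      a′ = (a - fromℕ ⟨ a , a∈ℤₚ ⟩ₚ) * 1/p^ 1
      r = ⟨ a , a∈ℤₚ ⟩ₚ
      ha : Int a
      ha = integral a∈ℤₚ
      ha′ : Int a′
      ha′ = integral (_≡_[modp^_].quotient∈ℤₚ (proj₁ (proj₂ (residue a a∈ℤₚ))))

    instance
      a+1≢0 : ℚ.NonZero (a + 1ℚ)
      a+1≢0 = a≢-1⇒a+1≢0 a∈ℤₚ a≢-1

    p-multiple : ∀ {x y} → x ≡ y + P′ * ((x - y) * 1/p^ 1)
    p-multiple {x} {y} = begin
      x
        ≡⟨ solve 2 (λ x y → x := y :+ (x :- y) :* con 1ℚ) refl x y ⟩
      y + (x - y) * 1ℚ
        ≡⟨ cong (λ u → y + (x - y) * u) (P*1/p≡1 p-prime) ⟨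
      y + (x - y) * (P′ * 1/p^ 1)
        ≡⟨ solve 4 (λ y d p i → y :+ d :* (p :* i) := y :+ p :* (d :* i)) refl y (x - y) P′ (1/p^ 1) ⟩
      y + P′ * ((x - y) * 1/p^ 1) ∎
      where open ≡-Reasoning

    a≡r+pa′ : a ≡ fromℕ r + P′ * a′
    a≡r+pa′ = p-multiple {a} {fromℕ r}

    a+1∉p : ¬ Int ((a + 1ℚ) * 1/p^ 1)
    -- `a - - 1ℚ` reduces to `a + 1ℚ`, so `h` is the quotient part of the excluded congruence.
    a+1∉p (integral h) = a≢-1 (congruent a∈ℤₚ (Integral.∈ℤₚ (negᴵ (ℕᴵ 1))) h)

    -- If `r` were `m = p - 1`, then `a + 1` would be `p (a′ + 1)`, against `a+1∉p`.
    r<m : r ℕ.< m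
    r<m = ℕ.≤∧≢⇒< (ℕ.s≤s⁻¹ (toℕ<n (proj₁ (residue a a∈ℤₚ)))) λ r≡m → a+1∉p
      (subst Int (sym (begin
        (a + 1ℚ) * 1/p^ 1
          ≡⟨ cong (λ x → (x + 1ℚ) * 1/p^ 1) (trans a≡r+pa′ (cong (λ k → fromℕ k + P′ * a′) r≡m)) ⟩
        (M + P′ * a′ + 1ℚ) * 1/p^ 1
          ≡⟨ cong (_* 1/p^ 1) (solve 2 (λ M t → M :+ t :+ con 1ℚ := con 1ℚ :+ M :+ t) refl M (P′ * a′)) ⟩
        (1ℚ + M + P′ * a′) * 1/p^ 1
          ≡⟨ cong (λ x → (x + P′ * a′) * 1/p^ 1) (fromℕ-suc m) ⟨
        (P′ + P′ * a′) * 1/p^ 1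
          ≡⟨ solve 3 (λ p α i → (p :+ p :* α) :* i := (p :* i) :* (α :+ con 1ℚ)) refl P′ a′ (1/p^ 1) ⟩
        P′ * 1/p^ 1 * (a′ + 1ℚ)
          ≡⟨ cong (_* (a′ + 1ℚ)) (P*1/p≡1 p-prime) ⟩
        1ℚ * (a′ + 1ℚ)
          ≡⟨ *-identityˡ (a′ + 1ℚ) ⟩
        a′ + 1ℚ ∎)) (ha′ +ᴵ ℕᴵ 1))
      where open ≡-Reasoning

    1/[a+1]-integral : Int (1/ (a + 1ℚ))
    1/[a+1]-integral = let y , hy , eq = unit⁻¹ p-prime (ha +ᴵ ℕᴵ 1) a+1∉p in
      subst Int (inverse-unique {a + 1ℚ} eq (*-inverseʳ (a + 1ℚ))) hy

    boundary-mod′ : ∃ λ z → Int z ×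
      boundary ≡ (a′ * (a′ + 1ℚ) ÷ (a + 1ℚ)) * fromℕ (p ^ 3) + fromℕ (p ^ 4) * z
    boundary-mod′ = cancel-unit p-prime {a + 1ℚ} {1/ (a + 1ℚ)} {boundary} {a′ * (a′ + 1ℚ)}
      (*-inverseʳ (a + 1ℚ)) 1/[a+1]-integral (boundary-mod r<m ha′ a≡r+pa′)

    mod-p⁴ : L p a ≡ a * (a + 1ℚ) * S p a - (a + 1ℚ) * (a + 1ℚ) * S p (a + 1ℚ)
                     + (a′ * (a′ + 1ℚ) ÷ (a + 1ℚ)) * fromℕ (p ^ 3) [modp^ 4 ]
    mod-p⁴ = let z , hz , eq = boundary-mod′ in mod-intro p-prime 4 (L-integral p-prime p∤2 ha)
      (ha *ᴵ hb *ᴵ S-integral p-prime p∤2 ha +ᴵ negᴵ (hb *ᴵ hb *ᴵ S-integral p-prime p∤2 hb)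
        +ᴵ ha′ *ᴵ (ha′ +ᴵ ℕᴵ 1) *ᴵ 1/[a+1]-integral *ᴵ ℕᴵ (p ^ 3))
      hz
      (trans (L-by-shift m a) (trans (cong (_+_ X) eq) (sym (+-assoc X Y (fromℕ (p ^ 4) * z)))))
      where
      hb = ha +ᴵ ℕᴵ 1
      X = a * (a + 1ℚ) * S p a - (a + 1ℚ) * (a + 1ℚ) * S p (a + 1ℚ)
      Y = (a′ * (a′ + 1ℚ) ÷ (a + 1ℚ)) * fromℕ (p ^ 3)

    module _ (a≢0 : ¬ (a ≡ 0ℚ [modp^ 1 ])) where

      -- `a + 1 + M` is `a + p`; subtracting `p / p` from an integral quotient would make `a / p`
      -- integral.
      a+p∉p : ¬ Int ((a + 1ℚ + M) * 1/p^ 1)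
      a+p∉p h = a≢0 (congruent a∈ℤₚ (Integral.∈ℤₚ (ℕᴵ 0)) (Integral.∈ℤₚ (subst Int (begin
        (a + 1ℚ + M) * 1/p^ 1 - 1ℚ
          ≡⟨ cong (λ u → (a + 1ℚ + M) * 1/p^ 1 - u) (trans (cong (_* 1/p^ 1) (sym (fromℕ-suc m))) (P*1/p≡1 p-prime)) ⟨
        (a + 1ℚ + M) * 1/p^ 1 - (1ℚ + M) * 1/p^ 1
          ≡⟨ solve 3 (λ a M i → (a :+ con 1ℚ :+ M) :* i :- (con 1ℚ :+ M) :* i := (a :- con 0ℚ) :* i) refl a M (1/p^ 1) ⟩
        (a - 0ℚ) * 1/p^ 1 ∎) (h +ᴵ negᴵ (ℕᴵ 1)))))
        where open ≡-Reasoning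

      p∤2p-1 : p ∤ suc (2 ℕ.* m)
      p∤2p-1 p∣ = p∤1 p-prime (∣m+n∣m⇒∣n {p} {suc (2 ℕ.* m)} {1}
        (subst (p ∣_) 2p≡ (n∣m*n 2)) p∣)
        where
        2p≡ : 2 ℕ.* suc m ≡ suc (2 ℕ.* m) ℕ.+ 1
        2p≡ = trans (ℕ.*-suc 2 m) (ℕ.+-comm 1 (suc (2 ℕ.* m)))

      T-mod-p³ : ∃ λ z → Int z × T a m ≡ fromℕ (p ^ 3) * z
      T-mod-p³ =
        let z , hz , eq        = boundary-mod′
            y , hy , [a+p]y≡1 = unit⁻¹ p-prime (ha +ᴵ ℕᴵ 1 +ᴵ ℕᴵ m) a+p∉p
        -- `y` and `u` invert the units `a + p` and `2p - 1`, so multiplying `boundary` by both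
        -- leaves `T a m`.
        in (Y + P′ * z) * (y * u) ,
        (ha′ *ᴵ (ha′ +ᴵ ℕᴵ 1) *ᴵ 1/[a+1]-integral +ᴵ ℕᴵ p *ᴵ hz)
          *ᴵ (hy *ᴵ 1/ℕ-integral p-prime {suc (2 ℕ.* m)} p∤2p-1) , (begin
        t
          ≡⟨ solve 1 (λ t → t := con 1ℚ :* con 1ℚ :* t) refl t ⟩
        1ℚ * 1ℚ * t
          ≡⟨ cong₂ (λ u v → u * v * t) [2p-1]u≡1 [a+p]y≡1 ⟨
        (1ℚ + fromℕ 2 * M) * u * ((a + 1ℚ + M) * y) * t
          ≡⟨ solve 5 (λ c u b y t → c :* u :* (b :* y) :* t := c :* b :* t :* (y :* u))
               refl (1ℚ + fromℕ 2 * M) u (a + 1ℚ + M) y t ⟩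
        boundary * (y * u)
          ≡⟨ cong (_* (y * u)) eq ⟩
        (Y * fromℕ (p ^ 3) + fromℕ (p ^ 4) * z) * (y * u)
          ≡⟨ cong (λ x → (Y * fromℕ (p ^ 3) + x * z) * (y * u)) (fromℕ-p^-suc p-prime 3) ⟩
        (Y * fromℕ (p ^ 3) + P′ * fromℕ (p ^ 3) * z) * (y * u)
          ≡⟨ solve 5 (λ Y q p z w → (Y :* q :+ p :* q :* z) :* w := q :* ((Y :+ p :* z) :* w))
               refl Y (fromℕ (p ^ 3)) P′ z (y * u) ⟩
        fromℕ (p ^ 3) * ((Y + P′ * z) * (y * u)) ∎)
        where
        open ≡-Reasoning
        t = T a m
        u = 1/ℕ (suc (2 ℕ.* m))
        Y = a′ * (a′ + 1ℚ) ÷ (a + 1ℚ)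
        [2p-1]u≡1 : (1ℚ + fromℕ 2 * M) * u ≡ 1ℚ
        [2p-1]u≡1 = trans
          (cong (_* u) (sym (trans (fromℕ-suc (2 ℕ.* m)) (cong (_+_ 1ℚ) (fromℕ-* 2 m)))))
          (fromℕ-1/ℕ (suc (2 ℕ.* m)))

      -- The boundary term of `L-by-R` is the integral number `D` times `T a m`, and p³ divides the
      -- latter.
      mod-p³ : L p a ≡ a * (a + 1ℚ) * (fromℕ 2 * S p a - R m a) [modp^ 3 ]
      mod-p³ = let z , hz , eq = T-mod-p³ in mod-intro p-prime 3 (L-integral p-prime p∤2 ha)
        (hA *ᴵ (ℕᴵ 2 *ᴵ S-integral p-prime p∤2 ha +ᴵ negᴵ (R-integral p-prime p∤2 (ℕ.n<1+n m) ha)))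
        ((ℕᴵ m *ᴵ (ℕᴵ 1 +ᴵ ℕᴵ 2 *ᴵ ℕᴵ m) +ᴵ negᴵ (ℕᴵ 2 *ᴵ hA)) *ᴵ hz)
        (trans (L-by-R m a) (cong (_+_ (a * (a + 1ℚ) * (fromℕ 2 * S p a - R m a)))
          (trans (cong (D *_) eq) (solve 3 (λ c q z → c :* (q :* z) := q :* (c :* z)) refl D (fromℕ (p ^ 3)) z))))
        where
        hA = ha *ᴵ (ha +ᴵ ℕᴵ 1)
        D = M * (1ℚ + fromℕ 2 * M) - fromℕ 2 * (a * (a + 1ℚ))

theorem4p1 : (p : ℕ) (p-prime : Prime p) → 2 ∤ p →
    let open AtPrime p-prime in
    (a : ℚ) (a∈ℤₚ : a ∈ℤₚ) (a≢-1 : ¬ (a ≡ - 1ℚ [modp^ 1 ])) →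
    let a′ = (a - fromℕ ⟨ a , a∈ℤₚ ⟩ₚ) * 1/p^ 1 in
    ((∑[ k < p ] (B a (toℕ k) * fromℕ (toℕ k) * 1/4^ (toℕ k)))
    ≡ a * (a + 1ℚ) * S p a
    - (a + 1ℚ) * (a + 1ℚ) * S p (a + 1ℚ)
    + (a′ * (a′ + 1ℚ) ÷ (a + 1ℚ)) {{a≢-1⇒a+1≢0 a∈ℤₚ a≢-1}} * fromℕ (p ^ 3)
    [modp^ 4 ])
    ×
    (¬ (a ≡ 0ℚ [modp^ 1 ]) →
    (∑[ k < p ] (B a (toℕ k) * fromℕ (toℕ k) * 1/4^ (toℕ k)))
    ≡ a * (a + 1ℚ)
    * (fromℕ 2 * S p a
    - (∑[ k < p ∸ 1 ] (B a (toℕ k) * 1/4^ (toℕ k) * (+ 1 / suc (toℕ k)))))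
    [modp^ 3 ])
theorem4p1 zero    p-prime 2∤p = ⊥-elim (¬prime[0] p-prime)
-- With p written as `suc m`, the length `p ∸ 1` reduces to `m`.
theorem4p1 (suc m) p-prime 2∤p a a∈ℤₚ a≢-1 =
  mod-p⁴ p-prime 2∤p a∈ℤₚ a≢-1 , mod-p³ p-prime 2∤p a∈ℤₚ a≢-1
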